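{- Let $k\ge 1$ be an integer and let $G$ be a finite simple graph that is claw-free and minimal $k$-factor-critical. If $G$ is $(k+1)$-connected, then $G$ has at least $\frac{k-1}{2k}|V(G)|$ vertices of degree $k+1$.
   Context: A graph $G$ of order $n$ is $k$-factor-critical (for an integer $1\le k<n$) if for every set $X$ of $k$ vertices, $G-X$ has a perfect matching. A $k$-factor-critical graph $G$ is minimal if for every edge $e$ of $G$, the graph $G-e$ is not $k$-factor-critical. A graph is claw-free if it has no induced subgraph isomorphic to $K_{1,3}$. -}

module Defs where

open import Data.Nat using (ℕ; zero; suc; _+_; _*_; _∸_; _≤_; _<_)
open import Data.Nat.Properties using (_≟_)
open import Data.Fin using (Fin)
open import Data.Fin.Subset using (Subset; _∈_; _∉_; ∣_∣)
open import Data.Vec using (tabulate)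
open import Data.Bool using (Bool; true; false; _∧_; not)
open import Data.Product using (Σ; ∃; _×_; _,_)
open import Relation.Binary.PropositionalEquality using (_≡_; _≢_)
open import Relation.Nullary using (¬_)
open import Relation.Nullary.Decidable using (⌊_⌋)
open import Data.Fin using () renaming (_≟_ to _≟ᶠ_)

record Graph (n : ℕ) : Set where
  field
    adj    : Fin n → Fin n → Bool
    sym    : ∀ u v → adj u v ≡ adj v u
    irrefl : ∀ v → adj v v ≡ false
open Graph public

deleteEdge : ∀ {n} → Graph n → Fin n → Fin n → Graph n
deleteEdge {n} G a b = record { adj = adj' ; sym = sym' ; irrefl = irr' }
  where
  isE : Fin n → Fin n → Bool
  isE u v = (⌊ u ≟ᶠ a ⌋ ∧ ⌊ v ≟ᶠ b ⌋) Data.Bool.∨ (⌊ u ≟ᶠ b ⌋ ∧ ⌊ v ≟ᶠ a ⌋)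
  adj' : Fin n → Fin n → Bool
  adj' u v = adj G u v ∧ not (isE u v)
  open import Relation.Binary.PropositionalEquality using (cong₂; refl)
  open import Data.Bool.Properties using (∧-comm; ∨-comm)
  isE-sym : ∀ u v → isE u v ≡ isE v u
  isE-sym u v rewrite ∧-comm ⌊ u ≟ᶠ a ⌋ ⌊ v ≟ᶠ b ⌋ | ∧-comm ⌊ u ≟ᶠ b ⌋ ⌊ v ≟ᶠ a ⌋
    = ∨-comm (⌊ v ≟ᶠ b ⌋ ∧ ⌊ u ≟ᶠ a ⌋) (⌊ v ≟ᶠ a ⌋ ∧ ⌊ u ≟ᶠ b ⌋)
  sym' : ∀ u v → adj' u v ≡ adj' v u
  sym' u v = cong₂ (λ x y → x ∧ not y) (sym G u v) (isE-sym u v)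
  irr' : ∀ v → adj' v v ≡ false
  irr' v rewrite irrefl G v = refl

record PerfectMatchingMinus {n : ℕ} (G : Graph n) (X : Subset n) : Set where
  field
    M        : Fin n → Fin n → Bool
    M-sym    : ∀ u v → M u v ≡ M v u
    M-edge   : ∀ u v → M u v ≡ true → adj G u v ≡ true
    M-avoid  : ∀ u v → M u v ≡ true → u ∉ X
    M-unique : ∀ u → u ∉ X →
                 Σ (Fin n) λ v → (M u v ≡ true) × (∀ w → M u w ≡ true → w ≡ v)

FactorCritical : ∀ {n} → ℕ → Graph n → Set
FactorCritical {n} k G =
  (1 ≤ k) × (k < n) × (∀ (X : Subset n) → ∣ X ∣ ≡ k → PerfectMatchingMinus G X)

MinimalFactorCritical : ∀ {n} → ℕ → Graph n → Set
MinimalFactorCritical k G =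
  FactorCritical k G × (∀ u v → adj G u v ≡ true → ¬ FactorCritical k (deleteEdge G u v))

ClawFree : ∀ {n} → Graph n → Set
ClawFree {n} G = ∀ (c x y z : Fin n) →
  adj G c x ≡ true → adj G c y ≡ true → adj G c z ≡ true →
  x ≢ y → y ≢ z → x ≢ z →
  ¬ ((adj G x y ≡ false) × (adj G y z ≡ false) × (adj G x z ≡ false))

data Reach {n : ℕ} (G : Graph n) (X : Subset n) : Fin n → Fin n → Set where
  here : ∀ {u} → u ∉ X → Reach G X u u
  step : ∀ {u w v} → u ∉ X → adj G u w ≡ true → Reach G X w v → Reach G X u v

ConnectedMinus : ∀ {n} → Graph n → Subset n → Set
ConnectedMinus {n} G X = ∀ u v → u ∉ X → v ∉ X → Reach G X u v

Connected : ∀ {n} → ℕ → Graph n → Set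
Connected {n} t G = (t < n) × (∀ (X : Subset n) → ∣ X ∣ < t → ConnectedMinus G X)

degree : ∀ {n} → Graph n → Fin n → ℕ
degree G u = ∣ tabulate (adj G u) ∣

numDegree : ∀ {n} → Graph n → ℕ → ℕ
numDegree G d = ∣ tabulate (λ u → ⌊ degree G u ≟ d ⌋) ∣

{-# OPTIONS --safe #-}

-- Let u and v be adjacent vertices of degree at least k + 2 (and k ≥ 2; for k = 1 the bound is trivial).
-- Some G - uv - X with |X| = k has no perfect matching, so Tutte's theorem (by way of Gallai's lemma)
-- gives S with at least |S| - k + 2 components in G - uv - S.  In a claw-free graph a vertex of S meets
-- at most two components of G - S, while each component meets k + 1 vertices of S; this forces |S| ≤ k + 1.
-- If |S| = k, then uv is the only edge between the sides of a separation of order k ("split"); if |S| = k + 1,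
-- then u and v are singleton components and have the same closed neighbourhood ("twins").  A vertex has at most
-- one twin, and a triangle with two split edges is impossible by submodularity, as in Mader's theorem on
-- minimally k-connected graphs; hence, by claw-freeness, a vertex of degree at least k + 2 has at most 3
-- neighbours of degree at least k + 2, and so at least k - 1 neighbours of degree k + 1.  Counting the edges
-- between the two kinds of vertices gives (k - 1)(n - t) ≤ (k + 1) t.
module Submission where

open import Defs renaming (sym to adj-sym)
open import Data.Bool using (Bool; true; false; if_then_else_)
open import Data.Bool.Properties using (¬-not) renaming (_≟_ to _≟ᵇ_)
open import Data.Empty using (⊥)
open import Data.Fin using (Fin; zero; suc; _≟_) renaming (_<_ to _<ᶠ_)
open import Data.Fin.Permutation using (permutation)
import Data.Fin.Properties as Fin
open import Data.Fin.Properties using (any?; all?)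
open import Data.Fin.Subset using (Subset; ∣_∣; _∈_; _∉_)
open import Data.Fin.Subset.Properties using (_∈?_; anySubset?)
open import Data.Nat using (ℕ; zero; suc; _+_; _*_; _∸_; _≤_; _<_; z≤n; s≤s; _≤?_; _<?_)
import Data.Nat.Properties as ℕ
open import Data.Nat.Properties hiding (_≟_; _≤?_; _<?_)
open import Data.Nat.Tactic.RingSolver using (solve-∀)
open import Data.Product using (∃; _×_; _,_; proj₁; proj₂)
open import Data.Sum using (_⊎_; inj₁; inj₂)
open import Data.Vec using (Vec; []; _∷_; tabulate; lookup)
open import Data.Vec.Properties using (lookup∘tabulate; []=⇒lookup; lookup⇒[]=)
open import Function using (_∘_; mk⇔)
open import Relation.Binary.Definitions using (tri<; tri≈; tri>)
open import Relation.Binary.PropositionalEquality using (_≡_; _≢_; refl; sym; trans; cong; cong₂; subst; _≗_; module ≡-Reasoning)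
open import Relation.Nullary using (¬_; Dec; yes; no; does; contradiction; _×-dec_; _⊎-dec_; ¬?)
open import Relation.Nullary.Decidable using (⌊_⌋; map′; decidable-stable; does-⇔; dec-true; isYes≗does)
open import Algebra.Properties.CommutativeSemigroup +-commutativeSemigroup using (interchange)
open import Algebra.Properties.CommutativeMonoid.Sum +-0-commutativeMonoid using (sum; sum-cong-≗; ∑-distrib-+; ∑-comm; sum-permute)
open import Algebra.Properties.Semiring.Sum +-*-semiring using (*-distribˡ-sum)

-- Counting

𝟙 : Bool → ℕ
𝟙 b = if b then 1 else 0

χ : ∀ {n} {P : Fin n → Set} → (∀ x → Dec (P x)) → Fin n → ℕ
χ P? x = 𝟙 (does (P? x))

# : ∀ {n} {P : Fin n → Set} → (∀ x → Dec (P x)) → ℕ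
# P? = sum (χ P?)

sum-mono : ∀ {n} {f g : Fin n → ℕ} → (∀ x → f x ≤ g x) → sum f ≤ sum g
sum-mono {zero}  h = z≤n
sum-mono {suc n} h = +-mono-≤ (h zero) (sum-mono (h ∘ suc))

sum-mono-< : ∀ {n} {f g : Fin n → ℕ} → (∀ x → f x ≤ g x) → ∀ a → f a < g a → sum f < sum g
sum-mono-< h zero    lt = +-mono-<-≤ lt (sum-mono (h ∘ suc))
sum-mono-< h (suc a) lt = +-mono-≤-< (h zero) (sum-mono-< (h ∘ suc) a lt)

size-tabulate : ∀ {n} (f : Fin n → Bool) → ∣ tabulate f ∣ ≡ sum (𝟙 ∘ f)
size-tabulate {zero}  f = refl
size-tabulate {suc n} f with f zero
... | true  = cong suc (size-tabulate (f ∘ suc))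
... | false = size-tabulate (f ∘ suc)

𝟙-mono : ∀ {A B : Set} (a? : Dec A) (b? : Dec B) → (A → B) → 𝟙 (does a?) ≤ 𝟙 (does b?)
𝟙-mono (yes a) (yes b) h = ≤-refl
𝟙-mono (yes a) (no ¬b) h = contradiction (h a) ¬b
𝟙-mono (no ¬a) b?      h = z≤n

module _ {n : ℕ} {P Q : Fin n → Set} (P? : ∀ x → Dec (P x)) (Q? : ∀ x → Dec (Q x)) where

  #-mono : (∀ x → P x → Q x) → # P? ≤ # Q?
  #-mono h = sum-mono (λ x → 𝟙-mono (P? x) (Q? x) (h x))

  #-mono-< : (∀ x → P x → Q x) → ∀ a → Q a → ¬ P a → # P? < # Q?
  #-mono-< h a qa ¬pa = sum-mono-< (λ x → 𝟙-mono (P? x) (Q? x) (h x)) a lt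
    where
    lt : 𝟙 (does (P? a)) < 𝟙 (does (Q? a))
    lt with P? a | Q? a
    ... | yes pa | _      = contradiction pa ¬pa
    ... | no _   | yes _  = s≤s z≤n
    ... | no _   | no ¬qa = contradiction qa ¬qa

  #-∪ : # (λ x → P? x ⊎-dec Q? x) ≤ # P? + # Q?
  #-∪ = ≤-trans (sum-mono pointwise) (≤-reflexive (∑-distrib-+ (χ P?) (χ Q?)))
    where
    pointwise : ∀ x → 𝟙 (does (P? x ⊎-dec Q? x)) ≤ 𝟙 (does (P? x)) + 𝟙 (does (Q? x))
    pointwise x with P? x | Q? x
    ... | yes _ | _     = s≤s z≤n
    ... | no _  | yes _ = ≤-refl
    ... | no _  | no _  = z≤n

  #-split : # (λ x → P? x ×-dec Q? x) + # (λ x → P? x ×-dec ¬? (Q? x)) ≡ # P?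
  #-split = trans (sym (∑-distrib-+ (χ (λ x → P? x ×-dec Q? x)) (χ (λ x → P? x ×-dec ¬? (Q? x))))) (sum-cong-≗ pointwise)
    where
    pointwise : ∀ x → 𝟙 (does (P? x ×-dec Q? x)) + 𝟙 (does (P? x ×-dec ¬? (Q? x))) ≡ 𝟙 (does (P? x))
    pointwise x with P? x | Q? x
    ... | yes _ | yes _ = refl
    ... | yes _ | no _  = refl
    ... | no _  | yes _ = refl
    ... | no _  | no _  = refl

  -- An inclusion of finite sets that gains no element is an equality. This turns tight counting
  -- bounds into membership.
  ⊆-antitone-# : (∀ x → P x → Q x) → # Q? ≤ # P? → ∀ x → Q x → P x
  ⊆-antitone-# h le x qx with P? x
  ... | yes px = px
  ... | no ¬px = contradiction le (<⇒≱ (#-mono-< h x qx ¬px))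

#-cong : ∀ {n} {P Q : Fin n → Set} (P? : ∀ x → Dec (P x)) (Q? : ∀ x → Dec (Q x)) →
         (∀ x → P x → Q x) → (∀ x → Q x → P x) → # P? ≡ # Q?
#-cong P? Q? h h′ = ≤-antisym (#-mono P? Q? h) (#-mono Q? P? h′)

#-singleton : ∀ {n} (a : Fin n) → # (_≟ a) ≡ 1
#-singleton {suc n} zero    = cong suc (zeros n)
  where
  zeros : ∀ n → sum {n} (λ x → 𝟙 (does (Fin.suc x ≟ zero))) ≡ 0
  zeros zero    = refl
  zeros (suc n) = zeros n
#-singleton {suc n} (suc a) = #-singleton a

#-all : ∀ {n} {P : Fin n → Set} (P? : ∀ x → Dec (P x)) → (∀ x → P x) → # P? ≡ n
#-all {zero}  P? h = refl
#-all {suc n} P? h with P? zero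
... | yes _  = cong suc (#-all (P? ∘ suc) (h ∘ suc))
... | no ¬p₀ = contradiction (h zero) ¬p₀

#≤n : ∀ {n} {P : Fin n → Set} (P? : ∀ x → Dec (P x)) → # P? ≤ n
#≤n {zero}  P? = z≤n
#≤n {suc n} P? with P? zero
... | yes _ = s≤s (#≤n (P? ∘ suc))
... | no _  = m≤n⇒m≤1+n (#≤n (P? ∘ suc))

#-empty : ∀ {n} {P : Fin n → Set} (P? : ∀ x → Dec (P x)) → (∀ x → ¬ P x) → # P? ≤ 0
#-empty {zero}  P? h = z≤n
#-empty {suc n} P? h with P? zero
... | yes p₀ = contradiction p₀ (h zero)
... | no _   = #-empty (P? ∘ suc) (h ∘ suc)

#-disjoint : ∀ {n} {P Q R : Fin n → Set} (P? : ∀ x → Dec (P x)) (Q? : ∀ x → Dec (Q x)) (R? : ∀ x → Dec (R x)) →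
             (∀ x → P x → R x) → (∀ x → Q x → R x) → (∀ x → P x → ¬ Q x) → # P? + # Q? ≤ # R?
#-disjoint P? Q? R? P⊆R Q⊆R disj = ≤-trans
  (+-mono-≤ (#-mono P? (λ x → R? x ×-dec P? x) (λ x px → P⊆R x px , px))
            (#-mono Q? (λ x → R? x ×-dec ¬? (P? x)) (λ x qx → Q⊆R x qx , λ px → disj x px qx)))
  (≤-reflexive (#-split R? P?))

module _ {n : ℕ} {P : Fin n → Set} (P? : ∀ x → Dec (P x)) where

  _-?_ : ∀ a x → Dec (P x × x ≢ a)
  _-?_ a x = P? x ×-dec ¬? (x ≟ a)

  #-insert : ∀ a → # (λ x → P? x ⊎-dec (x ≟ a)) ≤ suc (# P?)
  #-insert a = ≤-trans (#-∪ P? (_≟ a)) (≤-reflexive (trans (cong (# P? +_) (#-singleton a)) (+-comm (# P?) 1)))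

  #-remove : ∀ a → # P? ≤ suc (# (_-?_ a))
  #-remove a = begin
    # P?                                                                 ≡⟨ sym (#-split P? (_≟ a)) ⟩
    # (λ x → P? x ×-dec (x ≟ a)) + # (_-?_ a)  ≤⟨ +-monoˡ-≤ _ (#-mono (λ x → P? x ×-dec (x ≟ a)) (_≟ a) (λ _ → proj₂)) ⟩
    # (_≟ a) + # (_-?_ a)                                                ≡⟨ cong (_+ # (_-?_ a)) (#-singleton a) ⟩
    suc (# (_-?_ a))                                                     ∎
    where open ≤-Reasoning

  #-pick : ∀ {m} → suc m ≤ # P? → ∃ λ a → P a × m ≤ # (_-?_ a)
  #-pick {m} lt with any? P?
  ... | yes (a , pa) = a , pa , ≤-pred (≤-trans lt (#-remove a))
  ... | no ¬∃        = contradiction (≤-trans lt (#-empty P? (λ x px → ¬∃ (x , px)))) λ ()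

-- Matchings as involutions

fix : ∀ {n} → (Fin n → Fin n) → ℕ
fix f = # (λ x → f x ≟ x)

fix-cong : ∀ {n} {f g : Fin n → Fin n} → f ≗ g → fix f ≡ fix g
fix-cong {f = f} {g} f≗g = #-cong (λ x → f x ≟ x) (λ x → g x ≟ x)
  (λ x → trans (sym (f≗g x))) (λ x → trans (f≗g x))

sum-ones : ∀ n → sum {n} (λ _ → 1) ≡ n
sum-ones zero    = refl
sum-ones (suc n) = cong suc (sum-ones n)

-- The moved points come in pairs: `f` exchanges those sent down with those sent up, so both kinds
-- are equally many.
fix-parity : ∀ {n} (f : Fin n → Fin n) → (∀ x → f (f x) ≡ x) → ∃ λ a → n ≡ a + a + fix f
fix-parity {n} f inv = # below? , sym (begin
  # below? + # below? + fix f  ≡⟨ cong (λ z → # below? + z + fix f) below≡above ⟩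
  # below? + # above? + fix f  ≡⟨ cong (_+ fix f) (sym (∑-distrib-+ (χ below?) (χ above?))) ⟩
  sum (λ x → χ below? x + χ above? x) + fix f
    ≡⟨ sym (∑-distrib-+ (λ x → χ below? x + χ above? x) (χ (λ x → f x ≟ x))) ⟩
  sum (λ x → χ below? x + χ above? x + χ (λ x → f x ≟ x) x)  ≡⟨ sum-cong-≗ one ⟩
  sum {n} (λ _ → 1)  ≡⟨ sum-ones n ⟩
  n  ∎)
  where
  open ≡-Reasoning
  below? : ∀ x → Dec (f x <ᶠ x)
  below? x = f x Fin.<? x
  above? : ∀ x → Dec (x <ᶠ f x)
  above? x = x Fin.<? f x
  below≡above : # below? ≡ # above?
  below≡above = trans (sum-permute (χ below?) (permutation f f inv inv))
    (#-cong (below? ∘ f) above?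
      (λ x → subst (_<ᶠ f x) (inv x)) (λ x → subst (_<ᶠ f x) (sym (inv x))))
  trichotomy : ∀ x (b : Dec (f x <ᶠ x)) (a : Dec (x <ᶠ f x)) (e : Dec (f x ≡ x)) →
               𝟙 (does b) + 𝟙 (does a) + 𝟙 (does e) ≡ 1
  trichotomy x (yes _) (no _)  (no _)  = refl
  trichotomy x (no _)  (yes _) (no _)  = refl
  trichotomy x (no _)  (no _)  (yes _) = refl
  trichotomy x (yes b) (yes a) _       = contradiction a (Fin.<-asym b)
  trichotomy x (yes b) (no _)  (yes e) = contradiction e (Fin.<⇒≢ b)
  trichotomy x (no _)  (yes a) (yes e) = contradiction (sym e) (Fin.<⇒≢ a)
  trichotomy x (no ¬b) (no ¬a) (no ¬e) with Fin.<-cmp (f x) x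
  ... | tri< b _ _ = contradiction b ¬b
  ... | tri≈ _ e _ = contradiction e ¬e
  ... | tri> _ _ a = contradiction a ¬a
  one : ∀ x → χ below? x + χ above? x + χ (λ x → f x ≟ x) x ≡ 1
  one x = trichotomy x (below? x) (above? x) (f x ≟ x)

halve : ∀ a {z} d → a + a + z ≡ d + d → ∃ λ c → z ≡ c + c
halve zero    d e = d , e
halve (suc a) {z} (suc d) e = halve a d (suc-injective (suc-injective
  (trans (cong (λ w → suc (w + z)) (sym (+-suc a a))) (trans e (cong suc (+-suc d d))))))

double-gap : ∀ s c → s + s < c + c → 2 + (s + s) ≤ c + c
double-gap s c lt with s <? c
... | yes s<c = subst (_≤ c + c) (cong suc (+-suc s s)) (+-mono-≤ s<c s<c)
... | no s≮c  = contradiction lt (≤⇒≯ (+-mono-≤ (≮⇒≥ s≮c) (≮⇒≥ s≮c)))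

mix : ∀ {n} {P : Fin n → Set} → (∀ x → Dec (P x)) → (f g : Fin n → Fin n) → Fin n → Fin n
mix P? f g x = if does (P? x) then f x else g x

module _ {n : ℕ} {P : Fin n → Set} (P? : ∀ x → Dec (P x)) (f g : Fin n → Fin n) where

  mix-in : ∀ x → P x → mix P? f g x ≡ f x
  mix-in x px with P? x
  ... | yes _  = refl
  ... | no ¬px = contradiction px ¬px

  mix-out : ∀ x → ¬ P x → mix P? f g x ≡ g x
  mix-out x ¬px with P? x
  ... | yes px = contradiction px ¬px
  ... | no _   = refl

  -- At every point the two mixtures take the values of `f` and `g` in some order.
  fix-mix : fix (mix P? f g) + fix (mix P? g f) ≡ fix f + fix g
  fix-mix = trans (sym (∑-distrib-+ (χ (λ x → mix P? f g x ≟ x)) (χ (λ x → mix P? g f x ≟ x))))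
    (trans (sum-cong-≗ pointwise) (∑-distrib-+ (χ (λ x → f x ≟ x)) (χ (λ x → g x ≟ x))))
    where
    pointwise : ∀ x → χ (λ x → mix P? f g x ≟ x) x + χ (λ x → mix P? g f x ≟ x) x
                      ≡ χ (λ x → f x ≟ x) x + χ (λ x → g x ≟ x) x
    pointwise x with P? x
    ... | yes _ = refl
    ... | no _  = +-comm (χ (λ x → g x ≟ x) x) (χ (λ x → f x ≟ x) x)

record Component {n : ℕ} (f g : Fin n → Fin n) (t u v : Fin n) : Set₁ where
  field
    P        : Fin n → Set
    P?       : ∀ x → Dec (P x)
    closed-f : ∀ x → P x → P (f x)
    closed-g : ∀ x → P x → P (g x)
    base     : P t
    separate : ¬ P u ⊎ ¬ P v

-- The component of t in the union of the two matchings is a path that starts at t,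
-- so f misses at most one of its vertices: the other end.  P is the part already walked, a its last vertex.
component : ∀ {n} (f g : Fin n → Fin n) → (∀ x → f (f x) ≡ x) → (∀ x → g (g x) ≡ x) →
            ∀ t u v → g t ≡ t → f u ≡ u → f v ≡ v → u ≢ v → Component f g t u v
component {n} f g ff gg t u v gt fu fv u≢v =
  walk n (_≟ t) t (m≤m+n n _) refl refl (λ { x refl → gt }) (λ x x≡t x≢t → contradiction x≡t x≢t)
  where
  walk : ∀ fuel {P : Fin n → Set} (P? : ∀ x → Dec (P x)) a → n ≤ fuel + # P? → P t → P a →
         (∀ x → P x → P (g x)) → (∀ x → P x → x ≢ a → P (f x) × f x ≢ a × f x ≢ x) → Component f g t u v
  walk fuel {P} P? a le pt pa clg clf with f a ≟ a
  ... | yes fa≡a = record { P = P ; P? = P? ; closed-f = closed ; closed-g = clg ; base = pt ; separate = sep }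
    where
    closed : ∀ x → P x → P (f x)
    closed x px with x ≟ a
    ... | yes refl = subst P (sym fa≡a) pa
    ... | no x≢a   = proj₁ (clf x px x≢a)
    sep : ¬ P u ⊎ ¬ P v
    sep with u ≟ a
    ... | yes refl = inj₂ (λ pv → proj₂ (proj₂ (clf v pv (u≢v ∘ sym))) fv)
    ... | no u≢a   = inj₁ (λ pu → proj₂ (proj₂ (clf u pu u≢a)) fu)
  ... | no fa≢a = next fuel le
    where
    b c : Fin n
    b = f a
    c = g b
    b∉P : ¬ P b
    b∉P pb = proj₁ (proj₂ (clf b pb fa≢a)) (ff a)
    c∉P : ¬ P c
    c∉P pc = b∉P (subst P (gg b) (clg c pc))
    Q? : ∀ x → Dec (P x ⊎ x ≡ b)
    Q? x = P? x ⊎-dec (x ≟ b)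
    smaller : # P? < # Q?
    smaller = #-mono-< P? Q? (λ _ → inj₁) b (inj₂ refl) b∉P
    -- Each round adds the new vertex `b` to the walked part, which has at most `n` vertices, so the
    -- initial fuel `n` suffices.
    next : ∀ fuel → n ≤ fuel + # P? → Component f g t u v
    next zero       le = contradiction (≤-trans smaller (#≤n Q?)) (≤⇒≯ le)
    next (suc fuel) le with c ≟ b
    -- The path ends at a vertex that `g` misses. Then `f` moves every vertex on it, and neither `u`
    -- nor `v` is among them.
    ... | yes c≡b = record { P = λ x → P x ⊎ x ≡ b ; P? = Q? ; closed-f = closed-f ; closed-g = closed-g
                           ; base = inj₁ pt ; separate = inj₁ sep }
      where
      closed-f : ∀ x → P x ⊎ x ≡ b → P (f x) ⊎ f x ≡ b
      closed-f x (inj₂ refl) = inj₁ (subst P (sym (ff a)) pa)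
      closed-f x (inj₁ px) with x ≟ a
      ... | yes refl = inj₂ refl
      ... | no x≢a   = inj₁ (proj₁ (clf x px x≢a))
      closed-g : ∀ x → P x ⊎ x ≡ b → P (g x) ⊎ g x ≡ b
      closed-g x (inj₂ refl) = inj₂ c≡b
      closed-g x (inj₁ px)   = inj₁ (clg x px)
      sep : ¬ (P u ⊎ u ≡ b)
      sep (inj₂ refl) = fa≢a (trans (sym fu) (ff a))
      sep (inj₁ pu) with u ≟ a
      ... | yes refl = fa≢a fu
      ... | no u≢a   = proj₂ (proj₂ (clf u pu u≢a)) fu
    ... | no c≢b = walk fuel Q′? c
      (≤-trans le (≤-trans (≤-reflexive (sym (+-suc fuel (# P?))))
        (+-monoʳ-≤ fuel (≤-trans smaller (#-mono Q? Q′? (λ _ → inj₁))))))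
      (inj₁ (inj₁ pt)) (inj₂ refl) clg′ clf′
      where
      Q′ : Fin n → Set
      Q′ x = (P x ⊎ x ≡ b) ⊎ x ≡ c
      Q′? : ∀ x → Dec (Q′ x)
      Q′? x = Q? x ⊎-dec (x ≟ c)
      clg′ : ∀ x → Q′ x → Q′ (g x)
      clg′ x (inj₁ (inj₁ px))   = inj₁ (inj₁ (clg x px))
      clg′ x (inj₁ (inj₂ refl)) = inj₂ refl
      clg′ x (inj₂ refl)        = inj₁ (inj₂ (gg b))
      clf′ : ∀ x → Q′ x → x ≢ c → Q′ (f x) × f x ≢ c × f x ≢ x
      clf′ x (inj₂ x≡c) x≢c = contradiction x≡c x≢c
      clf′ x (inj₁ (inj₂ refl)) x≢c =
        inj₁ (inj₁ (subst P (sym (ff a)) pa)) ,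
        (λ e → c∉P (subst P (trans (sym (ff a)) e) pa)) ,
        (λ e → fa≢a (trans (sym e) (ff a)))
      clf′ x (inj₁ (inj₁ px)) x≢c with x ≟ a
      ... | yes refl = inj₁ (inj₂ refl) , (λ e → c≢b (sym e)) , fa≢a
      ... | no x≢a with clf x px x≢a
      ...   | pfx , _ , fx≢x = inj₁ (inj₁ pfx) , (λ e → c∉P (subst P e pfx)) , fx≢x

-- Matchings of a graph and the search for them

∃vec? : ∀ {n m} {P : Vec (Fin n) m → Set} → (∀ v → Dec (P v)) → Dec (∃ P)
∃vec? {m = zero}  P? = map′ (λ p → [] , p) (λ { ([] , p) → p }) (P? [])
∃vec? {m = suc m} P? = map′ (λ { (x , v , p) → (x ∷ v) , p }) (λ { ((x ∷ v) , p) → x , v , p })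
  (any? (λ x → ∃vec? (λ v → P? (x ∷ v))))

module _ {n : ℕ} (H : Graph n) where

  -- A matching of `H - S` is the involution that swaps the ends of its edges. Uncovered vertices
  -- and those of `S` are fixed, so `fix` measures the defect, and the union of two matchings is
  -- traversed by applying the two maps in turn.
  record IsMatching (S : Fin n → Set) (f : Fin n → Fin n) : Set where
    field
      involutive : ∀ x → f (f x) ≡ x
      edge       : ∀ x → f x ≢ x → adj H x (f x) ≡ true
      avoids     : ∀ x → S x → f x ≡ x
  open IsMatching

  isMatching-cong : ∀ {S f g} → f ≗ g → IsMatching S f → IsMatching S g
  isMatching-cong {f = f} {g} f≗g m = record
    { involutive = λ x → trans (sym (f≗g (g x))) (trans (cong f (sym (f≗g x))) (involutive m x))
    ; edge       = λ x ne → subst (λ y → adj H x y ≡ true) (f≗g x) (edge m x (ne ∘ trans (sym (f≗g x))))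
    ; avoids     = λ x sx → trans (sym (f≗g x)) (avoids m x sx)
    }

  isMatching-⊆ : ∀ {S T f} → (∀ x → S x → T x) → IsMatching T f → IsMatching S f
  isMatching-⊆ S⊆T m = record
    { involutive = involutive m ; edge = edge m ; avoids = λ x sx → avoids m x (S⊆T x sx) }

  isMatching-id : ∀ {S} → IsMatching S (λ x → x)
  isMatching-id = record
    { involutive = λ _ → refl ; edge = λ x ne → contradiction refl ne ; avoids = λ _ _ → refl }

  isMatching? : ∀ {S} → (∀ x → Dec (S x)) → ∀ f → Dec (IsMatching S f)
  isMatching? {S} S? f = map′
    (λ (i , e , a) → record { involutive = i ; edge = λ x ne → edge-from x ne (e x) ; avoids = λ x sx → avoids-from x sx (a x) })
    (λ m → involutive m , (λ x → edge-to m x) , (λ x → avoids-to m x))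
    (all? (λ x → f (f x) ≟ x) ×-dec all? (λ x → (f x ≟ x) ⊎-dec (adj H x (f x) ≟ᵇ true))
      ×-dec all? (λ x → ¬? (S? x) ⊎-dec (f x ≟ x)))
    where
    edge-from : ∀ x → f x ≢ x → (f x ≡ x) ⊎ (adj H x (f x) ≡ true) → adj H x (f x) ≡ true
    edge-from x ne (inj₁ e) = contradiction e ne
    edge-from x ne (inj₂ e) = e
    avoids-from : ∀ x → S x → (¬ S x) ⊎ (f x ≡ x) → f x ≡ x
    avoids-from x sx (inj₁ ¬sx) = contradiction sx ¬sx
    avoids-from x sx (inj₂ e)   = e
    edge-to : IsMatching S f → ∀ x → (f x ≡ x) ⊎ (adj H x (f x) ≡ true)
    edge-to m x with f x ≟ x
    ... | yes e = inj₁ e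
    ... | no ne = inj₂ (edge m x ne)
    avoids-to : IsMatching S f → ∀ x → (¬ S x) ⊎ (f x ≡ x)
    avoids-to m x with S? x
    ... | yes sx = inj₂ (avoids m x sx)
    ... | no ¬sx = inj₁ ¬sx

  -- The search runs over tables of values, so `Q` must not distinguish pointwise equal maps.
  ∃matching? : ∀ {S} → (∀ x → Dec (S x)) → {Q : (Fin n → Fin n) → Set} → (∀ f → Dec (Q f)) →
               (∀ {f g} → f ≗ g → Q f → Q g) → Dec (∃ λ f → IsMatching S f × Q f)
  ∃matching? S? Q? Q-cong = map′
    (λ (v , m , q) → lookup v , m , q)
    (λ (f , m , q) → tabulate f , isMatching-cong (λ x → sym (lookup∘tabulate f x)) m
                                , Q-cong (λ x → sym (lookup∘tabulate f x)) q)
    (∃vec? {m = n} (λ v → isMatching? S? (lookup v) ×-dec Q? (lookup v)))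

  -- Both maps are involutions, so the complement of `P` is closed as well, and no edge of either
  -- matching leaves `P`.
  isMatching-mix : ∀ {S P} (P? : ∀ x → Dec (P x)) {f g} → IsMatching S f → IsMatching S g →
                   (∀ x → P x → P (f x)) → (∀ x → P x → P (g x)) → IsMatching S (mix P? f g)
  isMatching-mix {S} {P} P? {f} {g} mf mg clf clg = record { involutive = inv ; edge = edg ; avoids = avo }
    where
    clg′ : ∀ x → ¬ P x → ¬ P (g x)
    clg′ x ¬px pgx = ¬px (subst P (involutive mg x) (clg (g x) pgx))
    inv : ∀ x → mix P? f g (mix P? f g x) ≡ x
    inv x with P? x
    ... | yes px = trans (mix-in P? f g (f x) (clf x px)) (involutive mf x)
    ... | no ¬px = trans (mix-out P? f g (g x) (clg′ x ¬px)) (involutive mg x)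
    edg : ∀ x → mix P? f g x ≢ x → adj H x (mix P? f g x) ≡ true
    edg x ne with P? x
    ... | yes _ = edge mf x ne
    ... | no _  = edge mg x ne
    avo : ∀ x → S x → mix P? f g x ≡ x
    avo x sx with P? x
    ... | yes _ = avoids mf x sx
    ... | no _  = avoids mg x sx

  link : (x y : Fin n) → (Fin n → Fin n) → Fin n → Fin n
  link x y f z = if does (z ≟ x) then y else if does (z ≟ y) then x else f z

  module _ {S f} (m : IsMatching S f) {x y} (fx : f x ≡ x) (fy : f y ≡ y) (¬sx : ¬ S x) (¬sy : ¬ S y)
           (xy : adj H x y ≡ true) where

    private
      x≢y : x ≢ y
      x≢y refl = contradiction (trans (sym xy) (irrefl H x)) λ ()

      link-x : link x y f x ≡ y
      link-x with x ≟ x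
      ... | yes _  = refl
      ... | no x≢x = contradiction refl x≢x

      link-y : link x y f y ≡ x
      link-y with y ≟ x | y ≟ y
      ... | yes e | _      = e
      ... | no _  | yes _  = refl
      ... | no _  | no y≢y = contradiction refl y≢y

      link-other : ∀ z → z ≢ x → z ≢ y → link x y f z ≡ f z
      link-other z z≢x z≢y with z ≟ x | z ≟ y
      ... | yes e | _     = contradiction e z≢x
      ... | no _  | yes e = contradiction e z≢y
      ... | no _  | no _  = refl

    isMatching-link : IsMatching S (link x y f)
    isMatching-link = record { involutive = inv ; edge = edg ; avoids = avo }
      where
      inv : ∀ z → link x y f (link x y f z) ≡ z
      inv z with z ≟ x | z ≟ y
      ... | yes refl | _        = link-y
      ... | no _     | yes refl = link-x
      ... | no z≢x   | no z≢y   = trans (link-other (f z)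
        (λ e → z≢x (trans (sym (involutive m z)) (trans (cong f e) fx)))
        (λ e → z≢y (trans (sym (involutive m z)) (trans (cong f e) fy)))) (involutive m z)
      edg : ∀ z → link x y f z ≢ z → adj H z (link x y f z) ≡ true
      edg z ne with z ≟ x | z ≟ y
      ... | yes refl | _        = xy
      ... | no _     | yes refl = trans (adj-sym H y x) xy
      ... | no _     | no _     = edge m z ne
      avo : ∀ z → S z → link x y f z ≡ z
      avo z sz with z ≟ x | z ≟ y
      ... | yes refl | _        = contradiction sz ¬sx
      ... | no _     | yes refl = contradiction sz ¬sy
      ... | no _     | no _     = avoids m z sz

    fix-link : fix (link x y f) < fix f
    fix-link = #-mono-< (λ z → link x y f z ≟ z) (λ z → f z ≟ z) incl x fx (λ e → x≢y (trans (sym e) link-x))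
      where
      incl : ∀ z → link x y f z ≡ z → f z ≡ z
      incl z e with z ≟ x | z ≟ y
      ... | yes refl | _        = fx
      ... | no _     | yes refl = fy
      ... | no _     | no _     = e

-- Barriers

-- E plays the role of "lies in the same component of H - S", and R is a set of vertices in pairwise
-- different components.
record Barrier {n : ℕ} (H : Graph n) (k : ℕ) : Set₁ where
  field
    S       : Fin n → Set
    S?      : ∀ x → Dec (S x)
    R       : Fin n → Set
    R?      : ∀ x → Dec (R x)
    E       : Fin n → Fin n → Set
    E?      : ∀ x y → Dec (E x y)
    k≤∣S∣   : k ≤ # S?
    ∣R∣     : 2 + # S? ≤ # R? + k
    R∩S     : ∀ {x} → R x → ¬ S x
    E-refl  : ∀ {x} → E x x
    E-sym   : ∀ {x y} → E x y → E y x
    E-trans : ∀ {x y z} → E x y → E y z → E x z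
    E-adj   : ∀ {x y} → ¬ S x → ¬ S y → adj H x y ≡ true → E x y
    E-avoid : ∀ {x y} → E x y → ¬ S x → ¬ S y
    R-indep : ∀ {x y} → R x → R y → E x y → x ≡ y

-- A barrier from a maximal deficient set

module _ {n : ℕ} (H : Graph n) {k : ℕ} (a₀ : ℕ) (n-parity : n ≡ a₀ + a₀ + k) where

  open IsMatching

  -- fix f also counts the vertices of S, so f misses at most |S| - k vertices outside S.
  Short : (S : Fin n → Set) (S? : ∀ x → Dec (S x)) → Set
  Short S S? = ∃ λ f → IsMatching H S f × (fix f + k ≤ # S? + # S?)

  short? : ∀ {S : Fin n → Set} (S? : ∀ x → Dec (S x)) → Dec (Short S S?)
  short? S? = ∃matching? H S? (λ f → fix f + k ≤? # S? + # S?) (λ f≗g → subst (λ z → z + k ≤ # S? + # S?) (fix-cong f≗g))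

  insert? : ∀ {S : Fin n → Set} (S? : ∀ x → Dec (S x)) y x → Dec (S x ⊎ x ≡ y)
  insert? S? y x = S? x ⊎-dec (x ≟ y)

  -- Maximality supplies the hypothesis of Gallai's lemma: by it every vertex outside `S` is missed
  -- by some optimal matching of `H - S`.
  record MaximalDeficient : Set₁ where
    field
      S       : Fin n → Set
      S?      : ∀ x → Dec (S x)
      k≤∣S∣   : k ≤ # S?
      ¬short  : ¬ Short S S?
      maximal : ∀ y → ¬ S y → Short (λ x → S x ⊎ x ≡ y) (insert? S? y)

  maximalDeficient : ∀ {X : Fin n → Set} (X? : ∀ x → Dec (X x)) → k ≤ # X? → ¬ Short X X? → MaximalDeficient
  maximalDeficient X? = extend n X? (m≤m+n n _)
    where
    extend : ∀ fuel {S : Fin n → Set} (S? : ∀ x → Dec (S x)) → n ≤ fuel + # S? → k ≤ # S? → ¬ Short S S? → MaximalDeficient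
    extend fuel {S} S? le k≤ ¬sh with any? (λ y → ¬? (S? y) ×-dec ¬? (short? (insert? S? y)))
    ... | no ¬∃ = record { S = S ; S? = S? ; k≤∣S∣ = k≤ ; ¬short = ¬sh
                         ; maximal = λ y ¬sy → decidable-stable (short? (insert? S? y)) (λ ¬s → ¬∃ (y , ¬sy , ¬s)) }
    ... | yes (y , ¬sy , ¬sh′) = next fuel le
      where
      larger : # S? < # (insert? S? y)
      larger = #-mono-< S? (insert? S? y) (λ _ → inj₁) y (inj₂ refl) ¬sy
      next : ∀ fuel → n ≤ fuel + # S? → MaximalDeficient
      next zero       le = contradiction (≤-trans larger (#≤n (insert? S? y))) (≤⇒≯ le)
      next (suc fuel) le = extend fuel (insert? S? y)
        (≤-trans le (≤-trans (≤-reflexive (sym (+-suc fuel (# S?)))) (+-monoʳ-≤ fuel larger)))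
        (≤-trans k≤ (<⇒≤ larger)) ¬sh′

  barrier : ∀ {X : Fin n → Set} (X? : ∀ x → Dec (X x)) → # X? ≡ k →
            (∀ f → IsMatching H X f → k < fix f) → Barrier H k
  barrier {X} X? ∣X∣ bad = record
    { S = S ; S? = S? ; R = R ; R? = R? ; E = E ; E? = E? ; k≤∣S∣ = k≤∣S∣ ; ∣R∣ = ∣R∣
    ; R∩S = proj₂ ; E-refl = inj₁ refl ; E-sym = E-sym ; E-trans = E-trans
    ; E-adj = E-adj ; E-avoid = E-avoid ; R-indep = R-indep }
    where
    open MaximalDeficient (maximalDeficient X? (≤-reflexive (sym ∣X∣)) (λ (f , m , le) →
      <⇒≱ (bad f m) (+-cancelʳ-≤ k _ _ (subst (λ z → fix f + k ≤ z + z) ∣X∣ le))))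
    s : ℕ
    s = # S?

    -- By `n-parity` the number `fix f + k` is even. It exceeds `s + s` because nothing is short,
    -- hence it does so by at least 2.
    lower : ∀ {f} → IsMatching H S f → 2 + (s + s) ≤ fix f + k
    lower {f} m with fix-parity f (involutive m)
    ... | a , e with halve a (a₀ + k) (begin
          a + a + (fix f + k)  ≡⟨ sym (+-assoc (a + a) (fix f) k) ⟩
          a + a + fix f + k    ≡⟨ cong (_+ k) (trans (sym e) n-parity) ⟩
          a₀ + a₀ + k + k      ≡⟨ +-assoc (a₀ + a₀) k k ⟩
          a₀ + a₀ + (k + k)    ≡⟨ interchange a₀ a₀ k k ⟩
          a₀ + k + (a₀ + k)    ∎)
          where open ≡-Reasoning
    ...   | c , e′ = subst (2 + (s + s) ≤_) (sym e′)
              (double-gap s c (subst (s + s <_) e′ (≰⇒> (λ le → ¬short (f , m , le)))))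

    Opt : (Fin n → Fin n) → Set
    Opt f = IsMatching H S f × (fix f + k ≤ 2 + (s + s))

    -- One more vertex raises the allowance `s + s` by at most 2, so to no more than the bound in
    -- `lower`. A matching that is short for the larger set is therefore optimal, and it misses `y`.
    missing : ∀ y → ¬ S y → ∃ λ f → Opt f × f y ≡ y
    missing y ¬sy with maximal y ¬sy
    ... | f , m , le = f , (isMatching-⊆ H (λ _ → inj₁) m ,
            ≤-trans le (≤-trans (+-mono-≤ (#-insert S? y) (#-insert S? y)) (≤-reflexive (cong suc (+-suc s s))))) ,
          avoids m y (inj₂ refl)

    optimum : ∃ Opt
    optimum with any? (λ y → ¬? (S? y))
    ... | yes (y , ¬sy) = let (f , o , _) = missing y ¬sy in f , o
    ... | no ¬∃ = contradiction (isMatching-id H) (λ m → ¬short (_ , m ,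
            +-mono-≤ (≤-trans (#≤n (λ x → x ≟ x)) n≤s) k≤∣S∣))
      where
      n≤s : n ≤ s
      n≤s = ≤-reflexive (sym (#-all S? (λ y → decidable-stable (S? y) (λ ¬sy → ¬∃ (y , ¬sy)))))

    missing-any : ∀ y → ∃ λ f → Opt f × f y ≡ y
    missing-any y with S? y
    ... | no ¬sy = missing y ¬sy
    ... | yes sy = let (f , m , le) = optimum in f , (m , le) , avoids m y sy

    -- Gallai's relation: no optimal matching misses both vertices. Equality is a separate case,
    -- since every single vertex is fixed by some optimal matching.
    E : Fin n → Fin n → Set
    E x y = x ≡ y ⊎ ¬ (∃ λ f → IsMatching H S f × (fix f + k ≤ 2 + (s + s)) × f x ≡ x × f y ≡ y)

    E? : ∀ x y → Dec (E x y)
    E? x y = (x ≟ y) ⊎-dec ¬? (∃matching? H S?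
      (λ f → (fix f + k ≤? 2 + (s + s)) ×-dec (f x ≟ x) ×-dec (f y ≟ y))
      (λ f≗g (le , fx , fy) → subst (λ z → z + k ≤ 2 + (s + s)) (fix-cong f≗g) le ,
                              trans (sym (f≗g x)) fx , trans (sym (f≗g y)) fy))

    E-sym : ∀ {x y} → E x y → E y x
    E-sym (inj₁ e) = inj₁ (sym e)
    E-sym (inj₂ h) = inj₂ (λ (f , m , le , fy , fx) → h (f , m , le , fx , fy))

    -- The two mixtures together have as many fixed points as `f` and `g`, and neither can go below
    -- `lower`, so neither can stay above it.
    exchange : ∀ {P : Fin n → Set} (P? : ∀ x → Dec (P x)) {f g} → Opt f → Opt g →
               (∀ x → P x → P (f x)) → (∀ x → P x → P (g x)) → Opt (mix P? g f)
    exchange P? {f} {g} (mf , lf) (mg , lg) clf clg =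
      m₁ , +-cancelʳ-≤ L (fix (mix P? g f) + k) L (begin
        fix (mix P? g f) + k + L                       ≤⟨ +-monoʳ-≤ (fix (mix P? g f) + k) (lower m₂) ⟩
        fix (mix P? g f) + k + (fix (mix P? f g) + k)  ≡⟨ interchange (fix (mix P? g f)) k (fix (mix P? f g)) k ⟩
        fix (mix P? g f) + fix (mix P? f g) + (k + k)  ≡⟨ cong (_+ (k + k)) (fix-mix P? g f) ⟩
        fix g + fix f + (k + k)                        ≡⟨ interchange (fix g) (fix f) k k ⟩
        fix g + k + (fix f + k)                        ≤⟨ +-mono-≤ lg lf ⟩
        L + L                                          ∎)
      where
      open ≤-Reasoning
      L : ℕ
      L = 2 + (s + s)
      m₁ : IsMatching H S (mix P? g f)
      m₁ = isMatching-mix H P? mg mf clg clf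
      m₂ : IsMatching H S (mix P? f g)
      m₂ = isMatching-mix H P? mf mg clf clg

    -- Gallai's lemma: exchanging f and g on the component of t gives an optimal matching
    -- that misses t together with u or with v.
    E-trans : ∀ {u t v} → E u t → E t v → E u v
    E-trans (inj₁ refl) tv          = tv
    E-trans (inj₂ ut)   (inj₁ refl) = inj₂ ut
    E-trans {u} {t} {v} (inj₂ ut) (inj₂ tv) with u ≟ v
    ... | yes u≡v = inj₁ u≡v
    ... | no u≢v  = inj₂ impossible
      where
      impossible : ¬ (∃ λ f → IsMatching H S f × (fix f + k ≤ 2 + (s + s)) × f u ≡ u × f v ≡ v)
      impossible (f , mf , lf , fu , fv) with missing-any t
      ... | g , (mg , lg) , gt with component f g (involutive mf) (involutive mg) t u v gt fu fv u≢v
      ...   | record { P = P ; P? = P? ; closed-f = clf ; closed-g = clg ; base = pt ; separate = sep } = conclude sep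
        where
        o : Opt (mix P? g f)
        o = exchange P? (mf , lf) (mg , lg) clf clg
        ht : mix P? g f t ≡ t
        ht = trans (mix-in P? g f t pt) gt
        conclude : ¬ P u ⊎ ¬ P v → ⊥
        conclude (inj₁ ¬pu) = ut (mix P? g f , proj₁ o , proj₂ o , trans (mix-out P? g f u ¬pu) fu , ht)
        conclude (inj₂ ¬pv) = tv (mix P? g f , proj₁ o , proj₂ o , ht , trans (mix-out P? g f v ¬pv) fv)

    -- An optimal matching that missed both ends could be enlarged by the edge, against `lower`.
    E-adj : ∀ {x y} → ¬ S x → ¬ S y → adj H x y ≡ true → E x y
    E-adj ¬sx ¬sy xy = inj₂ (λ (f , m , le , fx , fy) →
      <⇒≱ (+-monoˡ-< k (fix-link H m fx fy ¬sx ¬sy xy))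
          (≤-trans le (lower (isMatching-link H m fx fy ¬sx ¬sy xy))))

    -- An optimal matching that misses `x` also fixes every vertex of `S`, so `x` is related to none
    -- of them.
    E-avoid : ∀ {x y} → E x y → ¬ S x → ¬ S y
    E-avoid (inj₁ refl) ¬sx = ¬sx
    E-avoid {x} {y} (inj₂ h) ¬sx sy with missing x ¬sx
    ... | f , (m , le) , fx = h (f , m , le , fx , avoids m y sy)

    f₀ : Fin n → Fin n
    f₀ = proj₁ optimum

    -- Distinct vertices missed by the same optimal matching `f₀` are unrelated. At most `s` of its
    -- fixed points lie in `S`, and `lower` bounds their total number from below, which gives `∣R∣`.
    R : Fin n → Set
    R x = f₀ x ≡ x × ¬ S x

    R? : ∀ x → Dec (R x)
    R? x = (f₀ x ≟ x) ×-dec ¬? (S? x)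

    ∣R∣ : 2 + s ≤ # R? + k
    ∣R∣ = +-cancelˡ-≤ s (2 + s) (# R? + k) (begin
      s + (2 + s)      ≡⟨ trans (+-suc s (suc s)) (cong suc (+-suc s s)) ⟩
      2 + (s + s)      ≤⟨ lower (proj₁ (proj₂ optimum)) ⟩
      fix f₀ + k       ≡⟨ cong (_+ k) (sym (#-split (λ x → f₀ x ≟ x) S?)) ⟩
      # (λ x → (f₀ x ≟ x) ×-dec S? x) + # R? + k
        ≤⟨ +-monoˡ-≤ k (+-monoˡ-≤ (# R?) (#-mono (λ x → (f₀ x ≟ x) ×-dec S? x) S? (λ _ → proj₂))) ⟩
      s + # R? + k     ≡⟨ +-assoc s (# R?) k ⟩
      s + (# R? + k)   ∎)
      where open ≤-Reasoning

    R-indep : ∀ {x y} → R x → R y → E x y → x ≡ y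
    R-indep _          _          (inj₁ e) = e
    R-indep (fx , _) (fy , _) (inj₂ h) =
      contradiction (f₀ , proj₁ (proj₂ optimum) , proj₂ (proj₂ optimum) , fx , fy) h

-- Factor-critical graphs and separators

does-true : ∀ {A : Set} (d : Dec A) → does d ≡ true → A
does-true (yes a) _ = a

size-# : ∀ {n} (X : Subset n) → ∣ X ∣ ≡ # (_∈? X)
size-# []          = refl
size-# (true  ∷ X) = cong suc (size-# X)
size-# (false ∷ X) = size-# X

adj? : ∀ {n} (G : Graph n) x y → Dec (adj G x y ≡ true)
adj? G x y = adj G x y ≟ᵇ true

degree-# : ∀ {n} (G : Graph n) u → degree G u ≡ # (adj? G u)
degree-# G u = trans (size-tabulate (adj G u)) (sum-cong-≗ (λ x → 𝟙-≟ (adj G u x)))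
  where
  𝟙-≟ : ∀ b → 𝟙 b ≡ 𝟙 (does (b ≟ᵇ true))
  𝟙-≟ true  = refl
  𝟙-≟ false = refl

module _ {n : ℕ} (G : Graph n) where

  pmMatching : ∀ {X} → PerfectMatchingMinus G X → ∃ λ f → IsMatching G (_∈ X) f × fix f ≡ ∣ X ∣
  pmMatching {X} pm = f , record { involutive = inv ; edge = edg ; avoids = avo } , trans
      (#-cong (λ x → f x ≟ x) (_∈? X) fixed avo) (sym (size-# X))
    where
    open PerfectMatchingMinus pm
    f : Fin n → Fin n
    f x with x ∈? X
    ... | yes _  = x
    ... | no x∉X = proj₁ (M-unique x x∉X)
    matched : ∀ x → x ∉ X → M x (f x) ≡ true
    matched x x∉X with x ∈? X
    ... | yes x∈X = contradiction x∈X x∉X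
    ... | no x∉X′ = proj₁ (proj₂ (M-unique x x∉X′))
    unique : ∀ x y → M x y ≡ true → y ≡ f x
    unique x y xy with x ∈? X
    ... | yes x∈X = contradiction x∈X (M-avoid x y xy)
    ... | no x∉X  = proj₂ (proj₂ (M-unique x x∉X)) y xy
    avo : ∀ x → x ∈ X → f x ≡ x
    avo x x∈X with x ∈? X
    ... | yes _  = refl
    ... | no x∉X = contradiction x∈X x∉X
    inv : ∀ x → f (f x) ≡ x
    inv x = case (x ∈? X)
      where
      case : Dec (x ∈ X) → f (f x) ≡ x
      case (yes x∈X) = trans (cong f (avo x x∈X)) (avo x x∈X)
      case (no x∉X)  = sym (unique (f x) x (trans (M-sym (f x) x) (matched x x∉X)))
    edg : ∀ x → f x ≢ x → adj G x (f x) ≡ true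
    edg x ne = M-edge x (f x) (matched x (ne ∘ avo x))
    fixed : ∀ x → f x ≡ x → x ∈ X
    fixed x fx = decidable-stable (x ∈? X) (λ x∉X → contradiction
      (trans (sym (M-edge x x (subst (λ y → M x y ≡ true) fx (matched x x∉X)))) (irrefl G x)) λ ())

  matchingPM : ∀ {X f} → IsMatching G (_∈ X) f → fix f ≤ ∣ X ∣ → PerfectMatchingMinus G X
  matchingPM {X} {f} m le = record
    { M = λ x y → does (M? x y)
    ; M-sym = λ x y → does-⇔ (mk⇔ (flip x y) (flip y x)) (M? x y) (M? y x)
    ; M-edge = λ x y e → let (fx , ne) = does-true (M? x y) e in
        subst (λ z → adj G x z ≡ true) fx (edge x (λ e′ → ne (trans (sym e′) fx)))
    ; M-avoid = λ x y e x∈X → let (fx , ne) = does-true (M? x y) e in ne (trans (sym (avoids x x∈X)) fx)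
    ; M-unique = λ x x∉X → f x , dec-true (M? x (f x)) (refl , λ e → x∉X (fixed x (sym e)))
                               , λ y e → sym (proj₁ (does-true (M? x y) e))
    }
    where
    open IsMatching m
    M? : ∀ x y → Dec (f x ≡ y × x ≢ y)
    M? x y = (f x ≟ y) ×-dec ¬? (x ≟ y)
    flip : ∀ x y → f x ≡ y × x ≢ y → f y ≡ x × y ≢ x
    flip x y (fx , ne) = trans (cong f (sym fx)) (involutive x) , ne ∘ sym
    fixed : ∀ x → f x ≡ x → x ∈ X
    fixed = ⊆-antitone-# (_∈? X) (λ x → f x ≟ x) avoids (≤-trans le (≤-reflexive (size-# X)))

  perfect? : ∀ k X → Dec (∃ λ f → IsMatching G (_∈ X) f × fix f ≤ k)
  perfect? k X = ∃matching? G (_∈? X) (λ f → fix f ≤? k) (λ f≗g → subst (_≤ k) (fix-cong f≗g))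

  -- Sets and matchings can be searched exhaustively, so a failing set is obtained from the mere
  -- negation.
  nonCritical : ∀ {k} → 1 ≤ k → k < n → ¬ FactorCritical k G →
                ∃ λ X → ∣ X ∣ ≡ k × (∀ f → IsMatching G (_∈ X) f → k < fix f)
  nonCritical {k} 1≤k k<n ¬fc with anySubset? (λ X → (∣ X ∣ ℕ.≟ k) ×-dec ¬? (perfect? k X))
  ... | yes (X , ∣X∣ , none) = X , ∣X∣ , λ f m → ≰⇒> (λ le → none (f , m , le))
  ... | no all = contradiction (1≤k , k<n , λ X ∣X∣ →
          let (f , m , le) = decidable-stable (perfect? k X) (λ none → all (X , ∣X∣ , none))
          in matchingPM m (≤-trans le (≤-reflexive (sym ∣X∣)))) ¬fc

deleteEdge-adj : ∀ {n} (G : Graph n) a b {x y} → adj G x y ≡ true →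
                 adj (deleteEdge G a b) x y ≡ true ⊎ (x ≡ a × y ≡ b) ⊎ (x ≡ b × y ≡ a)
deleteEdge-adj G a b {x} {y} xy rewrite xy with x ≟ a | y ≟ b | x ≟ b | y ≟ a
... | yes p | yes q | _     | _     = inj₂ (inj₁ (p , q))
... | yes _ | no _  | yes p | yes q = inj₂ (inj₂ (p , q))
... | no _  | _     | yes p | yes q = inj₂ (inj₂ (p , q))
... | yes _ | no _  | yes _ | no _  = inj₁ refl
... | yes _ | no _  | no _  | _     = inj₁ refl
... | no _  | _     | yes _ | no _  = inj₁ refl
... | no _  | _     | no _  | _     = inj₁ refl

-- The failing set `X` comes from `G - uv`, while a perfect matching of `G - X` itself supplies the
-- parity of `n`.
edgeBarrier : ∀ {n k} {G : Graph n} → MinimalFactorCritical k G → ∀ u v → adj G u v ≡ true →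
              Barrier (deleteEdge G u v) k
edgeBarrier {n} {k} {G} ((1≤k , k<n , pms) , minimal) u v uv
  with nonCritical (deleteEdge G u v) 1≤k k<n (minimal u v uv)
... | X , ∣X∣ , bad with pmMatching G (pms X ∣X∣)
...   | f , m , fixf with fix-parity f (IsMatching.involutive m)
...     | a , n-parity = barrier (deleteEdge G u v) a (trans n-parity (cong (a + a +_) (trans fixf ∣X∣)))
            (_∈? X) (trans (sym (size-# X)) ∣X∣) bad

Reach-closed : ∀ {n} {G : Graph n} {X} {C : Fin n → Set} →
               (∀ {x y} → C x → adj G x y ≡ true → y ∉ X → C y) → ∀ {a z} → Reach G X a z → C a → C z
Reach-closed cl (here _) ca = ca
Reach-closed {G = G} {X} cl (step _ aw r) ca = Reach-closed cl r (cl ca aw (source r))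
  where
  source : ∀ {a z} → Reach G X a z → a ∉ X
  source (here a∉X)     = a∉X
  source (step a∉X _ _) = a∉X

-- A walk that starts in `C` and avoids `T` never leaves `C`, so `T` separates `a` from `z`. Stating
-- this with a closed set `C` keeps walks out of the later arguments.
cut : ∀ {n t} {G : Graph n} → Connected t G → {C T : Fin n → Set} (T? : ∀ x → Dec (T x)) → ∀ {a z} →
      C a → ¬ T a → ¬ C z → ¬ T z → (∀ {x y} → C x → adj G x y ≡ true → ¬ T y → C y) → t ≤ # T?
cut {n} {t} {G} (_ , conn) {C} {T} T? {a} {z} ca ¬ta ¬cz ¬tz closed with t ≤? # T?
... | yes le = le
... | no ¬le = contradiction (Reach-closed (λ cx xy y∉X → closed cx xy (y∉X ∘ T-in))
                 (conn X (subst (_< t) (sym (size-tabulate (does ∘ T?))) (≰⇒> ¬le)) a z (¬ta ∘ in-T) (¬tz ∘ in-T)) ca) ¬cz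
  where
  X : Subset n
  X = tabulate (does ∘ T?)
  in-T : ∀ {x} → x ∈ X → T x
  in-T {x} x∈X = does-true (T? x) (trans (sym (lookup∘tabulate (does ∘ T?) x)) ([]=⇒lookup x∈X))
  T-in : ∀ {x} → T x → x ∈ X
  T-in {x} tx = lookup⇒[]= x X (trans (lookup∘tabulate (does ∘ T?) x) (dec-true (T? x) tx))

-- The two types of edges between vertices of large degree

module _ {n : ℕ} (G : Graph n) where

  Adj : Fin n → Fin n → Set
  Adj x y = adj G x y ≡ true

  Adj-sym : ∀ {x y} → Adj x y → Adj y x
  Adj-sym {x} {y} xy = trans (adj-sym G y x) xy

  Adj⇒≢ : ∀ {x y} → Adj x y → x ≢ y
  Adj⇒≢ {x} xx refl = contradiction (trans (sym xx) (irrefl G x)) λ ()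

  claw-free : ClawFree G → ∀ {c x y z} → Adj c x → Adj c y → Adj c z → x ≢ y → y ≢ z → x ≢ z →
              ¬ Adj x y → ¬ Adj y z → ¬ Adj x z → ⊥
  claw-free cf {c} {x} {y} {z} cx cy cz x≢y y≢z x≢z xy yz xz =
    cf c x y z cx cy cz x≢y y≢z x≢z (¬-not xy , ¬-not yz , ¬-not xz)

  contact? : ∀ {S C : Fin n → Set} → (∀ x → Dec (S x)) → (∀ x → Dec (C x)) →
             ∀ w → Dec (S w × ∃ λ z → C z × Adj z w)
  contact? S? C? w = S? w ×-dec any? (λ z → C? z ×-dec adj? G z w)

  module _ {k : ℕ} (cf : ClawFree G) (conn : Connected (suc k) G) where

    -- Double counting of the contacts between S and the classes: each class meets at least k + 1
    -- vertices of S, and a vertex of S meeting three classes is the centre of a claw.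
    packing : ∀ {S : Fin n → Set} (S? : ∀ x → Dec (S x)) {K : Fin n → Fin n → Set} (K? : ∀ x y → Dec (K x y))
              {Q : Fin n → Set} (Q? : ∀ x → Dec (Q x)) →
              (∀ {x} → Q x → K x x) → (∀ {x w} → Q x → K x w → ¬ S w) →
              (∀ {x w w′} → Q x → K x w → Adj w w′ → ¬ S w′ → K x w′) →
              (∀ {x y w} → Q x → Q y → K x w → K y w → x ≡ y) →
              2 ≤ # Q? → suc k * # Q? ≤ 2 * # S?
    packing {S} S? {K} K? {Q} Q? K-refl K-avoid K-closed K-disj 2≤Q = begin
      suc k * # Q?                                        ≡⟨ *-distribˡ-sum (suc k) (χ Q?) ⟩
      sum (λ x → suc k * χ Q? x)                          ≤⟨ sum-mono many ⟩
      sum (λ x → sum (λ w → 𝟙 (does (meets? x w))))       ≡⟨ ∑-comm (λ x w → 𝟙 (does (meets? x w))) ⟩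
      sum (λ w → sum (λ x → 𝟙 (does (meets? x w))))       ≤⟨ sum-mono few ⟩
      sum (λ w → 2 * χ S? w)                              ≡⟨ sym (*-distribˡ-sum 2 (χ S?)) ⟩
      2 * # S?                                            ∎
      where
      open ≤-Reasoning
      Meets : Fin n → Fin n → Set
      Meets x w = Q x × S w × ∃ λ z → K x z × Adj z w
      meets? : ∀ x w → Dec (Meets x w)
      meets? x w = Q? x ×-dec contact? S? (K? x) w
      apart : ∀ {x y z z′} → Q x → Q y → x ≢ y → K x z → K y z′ → ¬ Adj z z′
      apart qx qy x≢y xz yz′ zz′ = x≢y (K-disj qx qy (K-closed qx xz zz′ (K-avoid qy yz′)) yz′)
      distinct : ∀ {x y z z′} → Q x → Q y → x ≢ y → K x z → K y z′ → z ≢ z′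
      distinct qx qy x≢y xz yz′ refl = x≢y (K-disj qx qy xz yz′)
      other : ∀ x → Q x → ∃ λ y → Q y × y ≢ x
      other x qx with #-pick (_-?_ Q? x) {0} (≤-pred (≤-trans 2≤Q (#-remove Q? x)))
      ... | y , qy , _ = y , qy
      many : ∀ x → suc k * χ Q? x ≤ # (meets? x)
      many x = case (Q? x)
        where
        case : (q : Dec (Q x)) → suc k * 𝟙 (does q) ≤ # (meets? x)
        case (no _)   = ≤-trans (≤-reflexive (*-zeroʳ (suc k))) z≤n
        case (yes qx) with other x qx
        ... | y , qy , y≢x = ≤-trans (≤-reflexive (*-identityʳ (suc k)))
          (cut conn {C = K x} (meets? x) (K-refl qx) (λ (_ , sx , _) → K-avoid qx (K-refl qx) sx)
            (λ xy → y≢x (K-disj qy qx (K-refl qy) xy)) (λ (_ , sy , _) → K-avoid qy (K-refl qy) sy)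
            (λ {w} {w′} xw ww′ ¬m → K-closed qx xw ww′ (λ sw′ → ¬m (qx , sw′ , w , xw , ww′))))
      few : ∀ w → # (λ x → meets? x w) ≤ 2 * χ S? w
      few w = case (S? w)
        where
        case : (s : Dec (S w)) → # (λ x → meets? x w) ≤ 2 * 𝟙 (does s)
        case (no ¬sw) = #-empty (λ x → meets? x w) (λ x (_ , sw , _) → ¬sw sw)
        case (yes _)  = ≮⇒≥ three
          where
          three : ¬ (2 < # (λ x → meets? x w))
          three lt with #-pick (λ x → meets? x w) lt
          ... | a , (qa , _ , za , aza , wa) , lt₁ with #-pick (_-?_ (λ x → meets? x w) a) lt₁
          ... | b , ((qb , _ , zb , bzb , wb) , b≢a) , lt₂
              with #-pick (_-?_ (_-?_ (λ x → meets? x w) a) b) lt₂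
          ... | c , (((qc , _ , zc , czc , wc) , c≢a) , c≢b) , _ =
            claw-free cf (Adj-sym wa) (Adj-sym wb) (Adj-sym wc)
              (distinct qa qb (b≢a ∘ sym) aza bzb) (distinct qb qc (c≢b ∘ sym) bzb czc)
              (distinct qa qc (c≢a ∘ sym) aza czc)
              (apart qa qb (b≢a ∘ sym) aza bzb) (apart qb qc (c≢b ∘ sym) bzb czc)
              (apart qa qc (c≢a ∘ sym) aza czc)

data Side : Set where
  mid left right : Side

_≟ˢ_ : (a b : Side) → Dec (a ≡ b)
mid   ≟ˢ mid   = yes refl
mid   ≟ˢ left  = no λ ()
mid   ≟ˢ right = no λ ()
left  ≟ˢ mid   = no λ ()
left  ≟ˢ left  = yes refl
left  ≟ˢ right = no λ ()
right ≟ˢ mid   = no λ ()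
right ≟ˢ left  = no λ ()
right ≟ˢ right = yes refl

module _ {n : ℕ} (G : Graph n) where

  -- The situation of Mader's theorem: `mid` separates `u` from `v` once the edge `uv` is deleted.
  -- With a three-colouring of the vertices, crossing two separations becomes a case analysis on
  -- pairs of colours.
  record Split (k : ℕ) (u v : Fin n) : Set where
    field
      side  : Fin n → Side
      order : # (λ x → side x ≟ˢ mid) ≡ k
      at-u  : side u ≡ left
      at-v  : side v ≡ right
      only  : ∀ {x y} → side x ≡ left → side y ≡ right → Adj G x y → x ≡ u × y ≡ v

  -- The field `exit` serves uniqueness: a common neighbour that has a neighbour outside the closed
  -- neighbourhood of `u` cannot be a second twin of `u`.
  record Twins (u v : Fin n) : Set where
    field
      to   : ∀ {w} → w ≢ v → Adj G u w → Adj G v w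
      from : ∀ {w} → w ≢ u → Adj G v w → Adj G u w
      exit : ∀ {w} → w ≢ v → Adj G u w → ∃ λ z → Adj G w z × z ≢ u × ¬ Adj G u z

-- In both bounds s is the order of the barrier and q a number of separated classes.
too-many : ∀ {k s q} → 1 ≤ k → k ≤ s → 2 + s ≤ q + k → ¬ (suc k * q ≤ 2 * s)
too-many {suc k} {s} {q} 1≤k k≤s le pack with m≤n⇒∃[o]m+o≡n k≤s
-- In terms of the original k, there are at least m + 2 classes when s = k + m, and (k + 1)(m + 2)
-- exceeds 2(k + m) by 2 + m(k - 1).
... | m , refl = contradiction (begin
    suc (2 * (suc k + m))                      ≤⟨ m≤m+n _ (1 + m * k) ⟩
    suc (2 * (suc k + m)) + (1 + m * k)        ≡⟨ identity k m ⟩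
    suc (suc k) * (2 + m)                      ≤⟨ *-monoʳ-≤ (suc (suc k)) (+-cancelʳ-≤ (suc k) (2 + m) q
                                                    (≤-trans (≤-reflexive (cong (2 +_) (+-comm m (suc k)))) le)) ⟩
    suc (suc k) * q                            ≤⟨ pack ⟩
    2 * (suc k + m)                            ∎) 1+n≰n
  where
  open ≤-Reasoning
  identity : ∀ k m → suc (2 * (suc k + m)) + (1 + m * k) ≡ suc (suc k) * (2 + m)
  identity = solve-∀

order-bound : ∀ {k s q} → 2 ≤ k → k ≤ s → 1 + s ≤ q + k → suc k * q ≤ 2 * s → s ≤ suc k
order-bound {suc zero} (s≤s ())
order-bound {suc (suc k)} {s} {q} 2≤k k≤s le pack with m≤n⇒∃[o]m+o≡n k≤s
... | zero  , refl = ≤-trans (≤-reflexive (+-identityʳ _)) (n≤1+n _)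
... | suc zero , refl = ≤-reflexive (+-comm (suc (suc k)) 1)
-- In terms of the original k, for s = k + d there are at least d + 1 classes. The packing bound
-- then amounts to (k - 1)(d - 1) ≤ 0, which fails for k ≥ 2 and d ≥ 2.
... | suc (suc m) , refl = contradiction (begin
    suc (2 * (2 + k + (2 + m)))                       ≤⟨ m≤m+n _ (m + k + m * k) ⟩
    suc (2 * (2 + k + (2 + m))) + (m + k + m * k)     ≡⟨ identity k m ⟩
    (3 + k) * (3 + m)                                 ≤⟨ *-monoʳ-≤ (3 + k) (+-cancelʳ-≤ (2 + k) (3 + m) q
                                                           (≤-trans (≤-reflexive (cong (1 +_) (+-comm (2 + m) (2 + k)))) le)) ⟩
    (3 + k) * q                                       ≤⟨ pack ⟩
    2 * (2 + k + (2 + m))                             ∎) 1+n≰n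
  where
  open ≤-Reasoning
  identity : ∀ k m → suc (2 * (2 + k + (2 + m))) + (m + k + m * k) ≡ (3 + k) * (3 + m)
  identity = solve-∀

-- Barriers of `G - uv`, seen in `G`

module _ {n : ℕ} {G H : Graph n} {k : ℕ} (cf : ClawFree G) (conn : Connected (suc k) G) (2≤k : 2 ≤ k)
         (B : Barrier H k) where

  open Barrier B

  private
    1≤k : 1 ≤ k
    1≤k = ≤-trans (s≤s z≤n) 2≤k

    two-classes : ∀ {a b} → 2 + a ≤ b + k → k ≤ a → 2 ≤ b
    two-classes {a} {b} le k≤a = +-cancelʳ-≤ k 2 b (≤-trans (+-monoʳ-≤ 2 k≤a) le)

  -- For `H = G - uv` this is `E-adj` carried over to `G`. The condition is symmetric in `u` and
  -- `v`, so each argument about `u` serves for `v` too.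
  Bridge : Fin n → Fin n → Set
  Bridge u v = ∀ {x y} → ¬ S x → ¬ S y → Adj G x y → E x y ⊎ (x ≡ u × y ≡ v) ⊎ (x ≡ v × y ≡ u)

  bridge-sym : ∀ {u v} → Bridge u v → Bridge v u
  bridge-sym br ¬sx ¬sy xy with br ¬sx ¬sy xy
  ... | inj₁ e        = inj₁ e
  ... | inj₂ (inj₁ p) = inj₂ (inj₂ p)
  ... | inj₂ (inj₂ p) = inj₂ (inj₁ p)

  -- The classes of u and v are merged, which makes every class closed in G - S.
  merged-packing : ∀ {u v} → Bridge u v → {Q : Fin n → Set} (Q? : ∀ x → Dec (Q x)) →
                   (∀ {x} → Q x → R x) → (∀ {x} → Q x → ¬ E x u) → 2 ≤ # Q? → suc k * # Q? ≤ 2 * # S?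
  merged-packing {u} {v} br {Q} Q? Q⊆R ¬Eu =
    packing G cf conn S? K? Q? (λ qx → R∩S (Q⊆R qx) , inj₁ E-refl) (λ _ → proj₁) closed disj
    where
    K : Fin n → Fin n → Set
    -- No member of `Q` is in the class of `u`, so that class can be handed to the member in the
    -- class of `v`, if there is one.
    K x w = ¬ S w × (E x w ⊎ (E x v × E u w))
    K? : ∀ x w → Dec (K x w)
    K? x w = ¬? (S? w) ×-dec (E? x w ⊎-dec (E? x v ×-dec E? u w))
    closed : ∀ {x w w′} → Q x → K x w → Adj G w w′ → ¬ S w′ → K x w′
    closed qx (¬sw , xw) ww′ ¬sw′ with br ¬sw ¬sw′ ww′
    closed qx (¬sw , inj₁ xw) ww′ ¬sw′        | inj₁ e = ¬sw′ , inj₁ (E-trans xw e)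
    closed qx (¬sw , inj₂ (xv , uw)) ww′ ¬sw′ | inj₁ e = ¬sw′ , inj₂ (xv , E-trans uw e)
    closed qx (¬sw , inj₁ xu) ww′ ¬sw′        | inj₂ (inj₁ (refl , refl)) = contradiction xu (¬Eu qx)
    closed qx (¬sw , inj₂ (xv , _)) ww′ ¬sw′  | inj₂ (inj₁ (refl , refl)) = ¬sw′ , inj₁ xv
    closed qx (¬sw , inj₁ xv) ww′ ¬sw′        | inj₂ (inj₂ (refl , refl)) = ¬sw′ , inj₂ (xv , E-refl)
    closed qx (¬sw , inj₂ (xv , _)) ww′ ¬sw′  | inj₂ (inj₂ (refl , refl)) = ¬sw′ , inj₂ (xv , E-refl)
    disj : ∀ {x y w} → Q x → Q y → K x w → K y w → x ≡ y
    disj qx qy (_ , inj₁ xw)       (_ , inj₁ yw)       = R-indep (Q⊆R qx) (Q⊆R qy) (E-trans xw (E-sym yw))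
    disj qx qy (_ , inj₁ xw)       (_ , inj₂ (_ , uw)) = contradiction (E-trans xw (E-sym uw)) (¬Eu qx)
    disj qx qy (_ , inj₂ (_ , uw)) (_ , inj₁ yw)       = contradiction (E-trans yw (E-sym uw)) (¬Eu qy)
    disj qx qy (_ , inj₂ (xv , _)) (_ , inj₂ (yv , _)) = R-indep (Q⊆R qx) (Q⊆R qy) (E-trans xv (E-sym yv))

  -- Otherwise all of `R` could be packed with merged classes, and `R` is too large for that.
  representative : ∀ {u v} → Bridge u v → ∃ λ r → R r × E r u
  representative {u} br with any? (λ r → R? r ×-dec E? r u)
  ... | yes found = found
  ... | no none   = contradiction
    (merged-packing br R? (λ r → r) (λ rx xu → none (_ , rx , xu)) (two-classes ∣R∣ k≤∣S∣))
    (too-many 1≤k k≤∣S∣ ∣R∣)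

  -- If `u` and `v` shared a class, every class would be closed in `G - S` without merging, and `R`
  -- would again be too large.
  bridge-ends : ∀ {u v} → Bridge u v → ¬ E u v
  bridge-ends {u} {v} br uv = too-many 1≤k k≤∣S∣ ∣R∣
    (packing G cf conn S? {K = λ x w → ¬ S w × E x w} (λ x w → ¬? (S? w) ×-dec E? x w) R?
      (λ rx → R∩S rx , E-refl) (λ _ → proj₁)
      (λ _ (¬sw , xw) ww′ ¬sw′ → ¬sw′ , E-trans xw (all-E ¬sw ¬sw′ ww′))
      (λ rx ry (_ , xw) (_ , yw) → R-indep rx ry (E-trans xw (E-sym yw))) (two-classes ∣R∣ k≤∣S∣))
    where
    all-E : ∀ {x y} → ¬ S x → ¬ S y → Adj G x y → E x y
    all-E ¬sx ¬sy xy with br ¬sx ¬sy xy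
    ... | inj₁ e                    = e
    ... | inj₂ (inj₁ (refl , refl)) = uv
    ... | inj₂ (inj₂ (refl , refl)) = E-sym uv

  bridge-end∉S : ∀ {u v} → Bridge u v → ¬ S u
  bridge-end∉S br with representative br
  ... | r , Rr , ru = E-avoid ru (R∩S Rr)

  split : ∀ {u v} → Bridge u v → # S? ≡ k → Split G k u v
  split {u} {v} br s≡k = record
    { side = side ; at-u = at-u ; at-v = at-v ; only = only
    ; order = trans (#-cong (λ x → side x ≟ˢ mid) S? side-mid mid-side) s≡k }
    where
    ¬su = bridge-end∉S br
    ¬sv = bridge-end∉S (bridge-sym br)
    ¬uv = bridge-ends br
    -- The class of `u` goes to the `left`; all other classes, that of `v` among them, go to the
    -- `right`.
    side : Fin n → Side
    side x with S? x | E? u x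
    ... | yes _ | _     = mid
    ... | no _  | yes _ = left
    ... | no _  | no _  = right
    side-mid : ∀ x → side x ≡ mid → S x
    side-mid x e with S? x | E? u x
    side-mid x e  | yes sx | _     = sx
    side-mid x () | no _   | yes _
    side-mid x () | no _   | no _
    mid-side : ∀ x → S x → side x ≡ mid
    mid-side x sx with S? x | E? u x
    ... | yes _ | _  = refl
    ... | no ¬sx | _ = contradiction sx ¬sx
    side-left : ∀ x → side x ≡ left → ¬ S x × E u x
    side-left x e with S? x | E? u x
    side-left x () | yes _  | _
    side-left x e  | no ¬sx | yes ux = ¬sx , ux
    side-left x () | no _   | no _
    side-right : ∀ x → side x ≡ right → ¬ S x × ¬ E u x
    side-right x e with S? x | E? u x
    side-right x () | yes _  | _
    side-right x () | no _   | yes _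
    side-right x e  | no ¬sx | no ¬ux = ¬sx , ¬ux
    at-u : side u ≡ left
    at-u with S? u | E? u u
    ... | yes su | _      = contradiction su ¬su
    ... | no _   | yes _  = refl
    ... | no _   | no ¬uu = contradiction E-refl ¬uu
    at-v : side v ≡ right
    at-v with S? v | E? u v
    ... | yes sv | _      = contradiction sv ¬sv
    ... | no _   | yes uv = contradiction uv ¬uv
    ... | no _   | no _   = refl
    only : ∀ {x y} → side x ≡ left → side y ≡ right → Adj G x y → x ≡ u × y ≡ v
    only {x} {y} lx ry xy with side-left x lx | side-right y ry
    ... | ¬sx , ux | ¬sy , ¬uy with br ¬sx ¬sy xy
    ...   | inj₁ e              = contradiction (E-trans ux e) ¬uy
    ...   | inj₂ (inj₁ p)       = p
    ...   | inj₂ (inj₂ (refl , _)) = contradiction ux ¬uv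

  record Third (u v : Fin n) : Set where
    field
      c       : Fin n
      ¬Ecu    : ¬ E c u
      ¬Ecv    : ¬ E c v
      ¬Sc     : ¬ S c
      s≤1+k   : # S? ≤ suc k
      contact : ∀ w → S w → ∃ λ z → E c z × Adj G z w

  -- Without the representative `a` of the class of `u`, the rest of `R` can be packed, and
  -- `order-bound` applies. The contacts of a third class form a cut, so there are at least `k + 1`
  -- of them, which is all of `S`.
  third : ∀ {u v} → Bridge u v → k < # S? → Third u v
  third {u} {v} br k<s with representative br | representative (bridge-sym br)
  ... | a , Ra , au | b , Rb , bv = result
    where
    q-bound : 1 + # S? ≤ # (_-?_ R? a) + k
    q-bound = ≤-pred (≤-trans ∣R∣ (+-monoˡ-≤ k (#-remove R? a)))
    2≤Q : 2 ≤ # (_-?_ R? a)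
    2≤Q = +-cancelʳ-≤ k 2 _ (≤-trans (s≤s k<s) q-bound)
    s≤1+k : # S? ≤ suc k
    s≤1+k = order-bound 2≤k k≤∣S∣ q-bound (merged-packing br (_-?_ R? a) proj₁
      (λ (Rx , x≢a) xu → x≢a (R-indep Rx Ra (E-trans xu (E-sym au)))) 2≤Q)
    result : Third u v
    result with #-pick (_-?_ (_-?_ R? a) b) {0} (≤-pred (≤-trans 2≤Q (#-remove (_-?_ R? a) b)))
    ... | c , ((Rc , c≢a) , c≢b) , _ = record
      { c = c ; ¬Ecu = ¬cu ; ¬Ecv = ¬cv ; ¬Sc = R∩S Rc ; s≤1+k = s≤1+k
      ; contact = λ w sw → proj₂ (⊆-antitone-# (contact? G S? (E? c)) S? (λ _ → proj₁) (≤-trans s≤1+k meets) w sw) }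
      where
      ¬cu : ¬ E c u
      ¬cu cu = c≢a (R-indep Rc Ra (E-trans cu (E-sym au)))
      ¬cv : ¬ E c v
      ¬cv cv = c≢b (R-indep Rc Rb (E-trans cv (E-sym bv)))
      closed : ∀ {x y} → E c x → Adj G x y → ¬ (S y × ∃ λ z → E c z × Adj G z y) → E c y
      closed {x} {y} cx xy ¬t with S? y
      ... | yes sy = contradiction (sy , x , cx , xy) ¬t
      ... | no ¬sy with br (E-avoid cx (R∩S Rc)) ¬sy xy
      ...   | inj₁ e                 = E-trans cx e
      ...   | inj₂ (inj₁ (refl , _)) = contradiction cx ¬cu
      ...   | inj₂ (inj₂ (refl , _)) = contradiction cx ¬cv
      meets : suc k ≤ # (contact? G S? (E? c))
      meets = cut conn {C = E c} (contact? G S? (E? c)) E-refl (λ (sc , _) → R∩S Rc sc) ¬cu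
        (λ (su , _) → bridge-end∉S br su) closed

  third-sym : ∀ {u v} → Third u v → Third v u
  third-sym t = record { c = c ; ¬Ecu = ¬Ecv ; ¬Ecv = ¬Ecu ; ¬Sc = ¬Sc ; s≤1+k = s≤1+k ; contact = contact }
    where open Third t

  -- Otherwise the class of u without u and the class of v have disjoint sets of at least k contacts in S:
  -- a common contact, which also meets the third class, would be the centre of a claw.
  singleton-class : ∀ {u v} → Bridge u v → Third u v → ∀ {x} → E u x → x ≡ u
  singleton-class {u} {v} br t {x} ux with x ≟ u
  ... | yes x≡u = x≡u
  ... | no x≢u  = contradiction (≤-trans (+-mono-≤ k≤T₁ k≤T₂) (≤-trans disjoint s≤1+k)) k+k≰1+k
    where
    open Third t
    ¬su = bridge-end∉S br
    ¬sv = bridge-end∉S (bridge-sym br)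
    ¬uv = bridge-ends br
    k+k≰1+k : ¬ (k + k ≤ suc k)
    k+k≰1+k le = contradiction (+-cancelʳ-≤ k k 1 le) (<⇒≱ 2≤k)
    C₁ C₂ : Fin n → Set
    C₁ z = E u z × z ≢ u
    C₂ z = E v z
    T₁? : ∀ w → Dec (S w × ∃ λ z → C₁ z × Adj G z w)
    T₁? = contact? G S? (λ z → E? u z ×-dec ¬? (z ≟ u))
    T₂? : ∀ w → Dec (S w × ∃ λ z → C₂ z × Adj G z w)
    T₂? = contact? G S? (E? v)
    closed₁ : ∀ {y z} → C₁ y → Adj G y z → ¬ ((S z × ∃ λ z′ → C₁ z′ × Adj G z′ z) ⊎ z ≡ u) → C₁ z
    closed₁ {y} {z} (uy , y≢u) yz ¬t with S? z
    ... | yes sz = contradiction (inj₁ (sz , y , (uy , y≢u) , yz)) ¬t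
    ... | no ¬sz with br (E-avoid uy ¬su) ¬sz yz
    ...   | inj₁ e                 = E-trans uy e , (λ z≡u → ¬t (inj₂ z≡u))
    ...   | inj₂ (inj₁ (y≡u , _))  = contradiction y≡u y≢u
    ...   | inj₂ (inj₂ (refl , _)) = contradiction uy ¬uv
    closed₂ : ∀ {y z} → C₂ y → Adj G y z → ¬ ((S z × ∃ λ z′ → C₂ z′ × Adj G z′ z) ⊎ z ≡ u) → C₂ z
    closed₂ {y} {z} vy yz ¬t with S? z
    ... | yes sz = contradiction (inj₁ (sz , y , vy , yz)) ¬t
    ... | no ¬sz with br (E-avoid vy ¬sv) ¬sz yz
    ...   | inj₁ e                 = E-trans vy e
    ...   | inj₂ (inj₁ (refl , _)) = contradiction (E-sym vy) ¬uv
    ...   | inj₂ (inj₂ (_ , z≡u))  = contradiction (inj₂ z≡u) ¬t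
    ¬T-c : ∀ {A : Set} → ¬ ((S c × A) ⊎ c ≡ u)
    ¬T-c (inj₁ (sc , _)) = ¬Sc sc
    ¬T-c (inj₂ refl)     = ¬Ecu E-refl
    ¬T-x : ∀ {A : Set} → ¬ ((S x × A) ⊎ x ≡ u)
    ¬T-x (inj₁ (sx , _)) = E-avoid ux ¬su sx
    ¬T-x (inj₂ x≡u)      = x≢u x≡u
    ¬T-v : ∀ {A : Set} → ¬ ((S v × A) ⊎ v ≡ u)
    ¬T-v (inj₁ (sv , _)) = ¬sv sv
    ¬T-v (inj₂ refl)     = ¬uv E-refl
    -- Apart from its contacts in `S`, either set can be left only through `u`. So the contacts
    -- together with `u` cut it off from the third class and number at least `k + 1`.
    k≤T₁ : k ≤ # T₁?
    k≤T₁ = ≤-pred (≤-trans (cut conn {C = C₁} (λ w → T₁? w ⊎-dec (w ≟ u)) (ux , x≢u) ¬T-x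
      (λ (uc , _) → ¬Ecu (E-sym uc)) ¬T-c closed₁) (#-insert T₁? u))
    k≤T₂ : k ≤ # T₂?
    k≤T₂ = ≤-pred (≤-trans (cut conn {C = C₂} (λ w → T₂? w ⊎-dec (w ≟ u)) E-refl ¬T-v
      (λ vc → ¬Ecv (E-sym vc)) ¬T-c closed₂) (#-insert T₂? u))
    disjoint : # T₁? + # T₂? ≤ # S?
    disjoint = #-disjoint T₁? T₂? S? (λ _ → proj₁) (λ _ → proj₁) common
      where
      common : ∀ w → (S w × ∃ λ z → C₁ z × Adj G z w) → ¬ (S w × ∃ λ z → C₂ z × Adj G z w)
      common w (sw , y , (uy , y≢u) , yw) (_ , z , vz , zw) with contact w sw
      ... | d , cd , dw = claw-free G cf (Adj-sym G yw) (Adj-sym G zw) (Adj-sym G dw)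
          (λ { refl → ¬uv (E-trans uy (E-sym vz)) }) (λ { refl → ¬Ecv (E-trans cd (E-sym vz)) })
          (λ { refl → ¬Ecu (E-trans cd (E-sym uy)) }) ¬yz ¬zd ¬yd
        where
        ¬sy = E-avoid uy ¬su
        ¬sz = E-avoid vz ¬sv
        ¬sd = E-avoid cd ¬Sc
        ¬yz : ¬ Adj G y z
        ¬yz yz with br ¬sy ¬sz yz
        ... | inj₁ e                 = ¬uv (E-trans uy (E-trans e (E-sym vz)))
        ... | inj₂ (inj₁ (y≡u , _))  = y≢u y≡u
        ... | inj₂ (inj₂ (refl , _)) = ¬uv uy
        ¬zd : ¬ Adj G z d
        ¬zd zd with br ¬sz ¬sd zd
        ... | inj₁ e                 = ¬Ecv (E-trans cd (E-sym (E-trans vz e)))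
        ... | inj₂ (inj₁ (_ , refl)) = ¬Ecv cd
        ... | inj₂ (inj₂ (_ , refl)) = ¬Ecu cd
        ¬yd : ¬ Adj G y d
        ¬yd yd with br ¬sy ¬sd yd
        ... | inj₁ e                 = ¬Ecu (E-trans cd (E-sym (E-trans uy e)))
        ... | inj₂ (inj₁ (_ , refl)) = ¬Ecv cd
        ... | inj₂ (inj₂ (_ , refl)) = ¬Ecu cd

  neighbour : ∀ {u v} → Bridge u v → Third u v → ∀ {w} → Adj G u w → S w ⊎ w ≡ v
  neighbour br t {w} uw with S? w
  ... | yes sw = inj₁ sw
  ... | no ¬sw with br (bridge-end∉S br) ¬sw uw
  ...   | inj₁ e                 = contradiction (sym (singleton-class br t e)) (Adj⇒≢ G uw)
  ...   | inj₂ (inj₁ (_ , w≡v))  = inj₂ w≡v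
  ...   | inj₂ (inj₂ (refl , _)) = contradiction E-refl (bridge-ends br)

  -- The set `S` and `v` leave room for at most `k + 2` neighbours of `u`, and its degree takes all
  -- of it.
  complete : ∀ {u v} → Bridge u v → Third u v → 2 + k ≤ # (adj? G u) → ∀ {w} → S w → Adj G u w
  complete {u} {v} br t deg {w} sw = ⊆-antitone-# (adj? G u) (λ w → S? w ⊎-dec (w ≟ v)) (λ _ → neighbour br t)
    (≤-trans (#-insert S? v) (≤-trans (s≤s (Third.s≤1+k t)) deg)) w (inj₁ sw)

  -- Both `u` and `v` are joined to all of `S`, and to nothing else but each other. Every vertex of
  -- `S` also has a neighbour in the third class, which provides `exit`.
  twins : ∀ {u v} → Bridge u v → Third u v → 2 + k ≤ # (adj? G u) → 2 + k ≤ # (adj? G v) → Twins G u v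
  twins {u} {v} br t deg-u deg-v = record { to = to ; from = from ; exit = exit }
    where
    open Third t
    br′ = bridge-sym br
    t′  = third-sym t
    to : ∀ {w} → w ≢ v → Adj G u w → Adj G v w
    to w≢v uw with neighbour br t uw
    ... | inj₁ sw  = complete br′ t′ deg-v sw
    ... | inj₂ w≡v = contradiction w≡v w≢v
    from : ∀ {w} → w ≢ u → Adj G v w → Adj G u w
    from w≢u vw with neighbour br′ t′ vw
    ... | inj₁ sw  = complete br t deg-u sw
    ... | inj₂ w≡u = contradiction w≡u w≢u
    exit : ∀ {w} → w ≢ v → Adj G u w → ∃ λ z → Adj G w z × z ≢ u × ¬ Adj G u z
    exit {w} w≢v uw with neighbour br t uw
    ... | inj₂ w≡v = contradiction w≡v w≢v
    ... | inj₁ sw with contact w sw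
    ...   | z , cz , zw = z , Adj-sym G zw , (λ { refl → ¬Ecu cz }) , outside
      where
      outside : ¬ Adj G u z
      outside uz with neighbour br t uz
      ... | inj₁ sz   = E-avoid cz ¬Sc sz
      ... | inj₂ refl = ¬Ecv cz

  classify : ∀ {u v} → Bridge u v → 2 + k ≤ # (adj? G u) → 2 + k ≤ # (adj? G v) → Split G k u v ⊎ Twins G u v
  classify br deg-u deg-v with m≤n⇒m<n∨m≡n k≤∣S∣
  ... | inj₁ k<s = inj₂ (twins br (third br k<s) deg-u deg-v)
  ... | inj₂ k≡s = inj₁ (split br (sym k≡s))

abstract

  edge-type : ∀ {n k} {G : Graph n} → ClawFree G → Connected (suc k) G → 2 ≤ k → MinimalFactorCritical k G →
              ∀ {u v} → Adj G u v → 2 + k ≤ # (adj? G u) → 2 + k ≤ # (adj? G v) → Split G k u v ⊎ Twins G u v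
  edge-type {k = k} {G} cf conn 2≤k mfc {u} {v} uv = from-barrier (edgeBarrier mfc u v uv)
    where
    from-barrier : Barrier (deleteEdge G u v) k →
                   2 + k ≤ # (adj? G u) → 2 + k ≤ # (adj? G v) → Split G k u v ⊎ Twins G u v
    from-barrier B = classify cf conn 2≤k B br
      where
      br : Bridge cf conn 2≤k B u v
      br ¬sx ¬sy xy with deleteEdge-adj G u v xy
      ... | inj₁ h = inj₁ (Barrier.E-adj B ¬sx ¬sy h)
      ... | inj₂ p = inj₂ p

-- Crossing separations

-- The separator that two crossing separations induce around the intersection of their sides d.
Corner : Side → Side → Side → Set
Corner d a b = (a ≡ mid × b ≡ mid) ⊎ (a ≡ mid × b ≡ d) ⊎ (a ≡ d × b ≡ mid)

corner? : ∀ d a b → Dec (Corner d a b)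
corner? d a b = ((a ≟ˢ mid) ×-dec (b ≟ˢ mid)) ⊎-dec ((a ≟ˢ mid) ×-dec (b ≟ˢ d)) ⊎-dec ((a ≟ˢ d) ×-dec (b ≟ˢ mid))

-- Submodularity in exact form, vertex by vertex: a vertex in both middles belongs to both corner
-- separators, and a vertex in just one middle to just one of them.
corner-sum : ∀ a b → 𝟙 (does (corner? left a b)) + 𝟙 (does (corner? right a b)) ≡ 𝟙 (does (a ≟ˢ mid)) + 𝟙 (does (b ≟ˢ mid))
corner-sum mid   mid   = refl
corner-sum mid   left  = refl
corner-sum mid   right = refl
corner-sum left  mid   = refl
corner-sum left  left  = refl
corner-sum left  right = refl
corner-sum right mid   = refl
corner-sum right left  = refl
corner-sum right right = refl

opposite : Side → Side
opposite mid   = mid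
opposite left  = right
opposite right = left

opposite-involutive : ∀ a → opposite (opposite a) ≡ a
opposite-involutive mid   = refl
opposite-involutive left  = refl
opposite-involutive right = refl

module _ {n : ℕ} {G : Graph n} {k : ℕ} where

  open Split

  size : ∀ {u v} → Split G k u v → Side → ℕ
  size p d = # (λ x → side p x ≟ˢ d)

  flip : ∀ {u v} → Split G k u v → Split G k v u
  flip {u} {v} p = record
    { side = opposite ∘ side p
    ; order = trans (#-cong (λ x → opposite (side p x) ≟ˢ mid) (λ x → side p x ≟ˢ mid)
                       (λ x → back (side p x)) (λ x → cong opposite)) (order p)
    ; at-u = cong opposite (at-v p)
    ; at-v = cong opposite (at-u p)
    ; only = λ {x} {y} lx ry xy → let (y≡u , x≡v) = only p (back (side p y) ry) (back (side p x) lx) (Adj-sym G xy)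
                                  in x≡v , y≡u
    }
    where
    back : ∀ a {b} → opposite a ≡ b → a ≡ opposite b
    back a refl = sym (opposite-involutive a)

  size-flip : ∀ {u v} (p : Split G k u v) d → size (flip p) (opposite d) ≡ size p d
  size-flip p d = #-cong (λ x → opposite (side p x) ≟ˢ opposite d) (λ x → side p x ≟ˢ d)
    (λ x e → trans (sym (opposite-involutive (side p x))) (trans (cong opposite e) (opposite-involutive d)))
    (λ x → cong opposite)

  module Triangle (conn : Connected (suc k) G) {v u w : Fin n} (p : Split G k v u) (q : Split G k v w)
                  (vu : Adj G v u) (vw : Adj G v w) (uw : Adj G u w) (deg : 2 + k ≤ # (adj? G v)) where

    -- On either side `w` would be the end of a crossing edge other than `vu`, being adjacent to
    -- both `u` and `v`.
    p-w : side p w ≡ mid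
    p-w with side p w in e
    ... | mid   = refl
    ... | left  = contradiction (sym (proj₁ (only p e (at-v p) (Adj-sym G uw)))) (Adj⇒≢ G vw)
    ... | right = contradiction (sym (proj₂ (only p (at-u p) e vw))) (Adj⇒≢ G uw)

    q-u : side q u ≡ mid
    q-u with side q u in e
    ... | mid   = refl
    ... | left  = contradiction (sym (proj₁ (only q e (at-v q) uw))) (Adj⇒≢ G vu)
    ... | right = contradiction (proj₂ (only q (at-u q) e vu)) (Adj⇒≢ G uw)

    T? : ∀ d x → Dec (Corner d (side p x) (side q x))
    T? d x = corner? d (side p x) (side q x)

    Inner : Fin n → Set
    Inner x = (side p x ≡ left × side q x ≡ left) × x ≢ v

    inner? : ∀ x → Dec (Inner x)
    inner? x = ((side p x ≟ˢ left) ×-dec (side q x ≟ˢ left)) ×-dec ¬? (x ≟ v)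

    -- The corner around v has order at least k, for otherwise it and v separate the rest of that corner,
    -- or deg v is at most k + 1.
    corner-left : k ≤ # (T? left)
    corner-left with any? inner?
    ... | yes (x , ix@((px , qx) , x≢v)) = ≤-pred (≤-trans (cut conn {C = Inner} (λ y → T? left y ⊎-dec (y ≟ v)) ix
            (¬T-x) (λ ((pu , _) , _) → contradiction (trans (sym pu) (at-v p)) λ ()) ¬T-u closed)
            (#-insert (T? left) v))
      where
      ¬T-x : ¬ (Corner left (side p x) (side q x) ⊎ x ≡ v)
      ¬T-x (inj₂ x≡v) = x≢v x≡v
      ¬T-x (inj₁ t) rewrite px | qx with t
      ... | inj₁ (() , _)
      ... | inj₂ (inj₁ (() , _))
      ... | inj₂ (inj₂ (_ , ()))
      ¬T-u : ¬ (Corner left (side p u) (side q u) ⊎ u ≡ v)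
      ¬T-u (inj₂ u≡v) = Adj⇒≢ G vu (sym u≡v)
      ¬T-u (inj₁ t) rewrite at-v p with t
      ... | inj₁ (() , _)
      ... | inj₂ (inj₁ (() , _))
      ... | inj₂ (inj₂ (() , _))
      closed : ∀ {x y} → Inner x → Adj G x y → ¬ (Corner left (side p y) (side q y) ⊎ y ≡ v) → Inner y
      closed {x} {y} ((px , qx) , x≢v) xy ¬t with side p y in py | side q y in qy
      ... | left  | left  = (refl , refl) , (¬t ∘ inj₂)
      ... | right | _     = contradiction (proj₁ (only p px py xy)) x≢v
      ... | left  | right = contradiction (proj₁ (only q qx qy xy)) x≢v
      ... | mid   | right = contradiction (proj₁ (only q qx qy xy)) x≢v
      ... | mid   | mid   = contradiction (inj₁ (inj₁ (refl , refl))) ¬t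
      ... | mid   | left  = contradiction (inj₁ (inj₂ (inj₁ (refl , refl)))) ¬t
      ... | left  | mid   = contradiction (inj₁ (inj₂ (inj₂ (refl , refl)))) ¬t
    ... | no none = ≤-pred (≤-pred (≤-trans deg (≤-trans
            (#-mono (adj? G v) (λ y → (T? left y ⊎-dec (y ≟ u)) ⊎-dec (y ≟ w)) (λ y → around y))
            (≤-trans (#-insert (λ y → T? left y ⊎-dec (y ≟ u)) w) (s≤s (#-insert (T? left) u))))))
      where
      around : ∀ y → Adj G v y → (Corner left (side p y) (side q y) ⊎ y ≡ u) ⊎ y ≡ w
      around y vy with side p y in py | side q y in qy
      ... | left  | left  = contradiction (y , (py , qy) , Adj⇒≢ G vy ∘ sym) none
      ... | right | _     = inj₁ (inj₂ (proj₂ (only p (at-u p) py vy)))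
      ... | left  | right = inj₂ (proj₂ (only q (at-u q) qy vy))
      ... | mid   | right = inj₂ (proj₂ (only q (at-u q) qy vy))
      ... | mid   | mid   = inj₁ (inj₁ (inj₁ (refl , refl)))
      ... | mid   | left  = inj₁ (inj₁ (inj₂ (inj₁ (refl , refl))))
      ... | left  | mid   = inj₁ (inj₁ (inj₂ (inj₂ (refl , refl))))

    -- By `corner-sum` the orders of the two corners add up to `k + k`, so the lower bound on one is
    -- an upper bound on the other.
    corner-right : # (T? right) ≤ k
    corner-right = +-cancelˡ-≤ k _ _ (begin
      k + # (T? right)             ≤⟨ +-monoˡ-≤ (# (T? right)) corner-left ⟩
      # (T? left) + # (T? right)   ≡⟨ sym (∑-distrib-+ (χ (T? left)) (χ (T? right))) ⟩
      sum (λ x → χ (T? left) x + χ (T? right) x)  ≡⟨ sum-cong-≗ (λ x → corner-sum (side p x) (side q x)) ⟩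
      sum (λ x → χ (λ x → side p x ≟ˢ mid) x + χ (λ x → side q x ≟ˢ mid) x)
        ≡⟨ ∑-distrib-+ (χ (λ x → side p x ≟ˢ mid)) (χ (λ x → side q x ≟ˢ mid)) ⟩
      size p mid + size q mid      ≡⟨ cong₂ _+_ (order p) (order q) ⟩
      k + k                        ∎)
      where open ≤-Reasoning

    -- Such a vertex would be cut off from `v` by a corner separator of order at most `k`. The
    -- crossing edges give no way out, since `u` is in the middle of `q` and `w` in the middle of
    -- `p`.
    no-right-right : ∀ x → side p x ≡ right → side q x ≢ right
    no-right-right x px qx = <⇒≱ (cut conn {C = λ y → side p y ≡ right × side q y ≡ right} (T? right)
        (px , qx) ¬T-x (λ (pv , _) → contradiction (trans (sym pv) (at-u p)) λ ()) ¬T-v closed) corner-right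
      where
      ¬T-x : ¬ Corner right (side p x) (side q x)
      ¬T-x t rewrite px | qx with t
      ... | inj₁ (() , _)
      ... | inj₂ (inj₁ (() , _))
      ... | inj₂ (inj₂ (_ , ()))
      ¬T-v : ¬ Corner right (side p v) (side q v)
      ¬T-v t rewrite at-u p with t
      ... | inj₁ (() , _)
      ... | inj₂ (inj₁ (() , _))
      ... | inj₂ (inj₂ (() , _))
      closed : ∀ {x y} → side p x ≡ right × side q x ≡ right → Adj G x y →
               ¬ Corner right (side p y) (side q y) → side p y ≡ right × side q y ≡ right
      closed {x} {y} (px , qx) xy ¬t with side p y in py | side q y in qy
      ... | right | right = refl , refl
      ... | left  | _     with only p py px (Adj-sym G xy)
      ...   | _ , refl    = contradiction (trans (sym q-u) qx) λ ()
      closed {x} {y} (px , qx) xy ¬t | right | left with only q qy qx (Adj-sym G xy)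
      ...   | _ , refl    = contradiction (trans (sym p-w) px) λ ()
      closed {x} {y} (px , qx) xy ¬t | mid | left with only q qy qx (Adj-sym G xy)
      ...   | _ , refl    = contradiction (trans (sym p-w) px) λ ()
      closed {x} {y} (px , qx) xy ¬t | mid   | mid   = contradiction (inj₁ (refl , refl)) ¬t
      closed {x} {y} (px , qx) xy ¬t | mid   | right = contradiction (inj₂ (inj₁ (refl , refl))) ¬t
      closed {x} {y} (px , qx) xy ¬t | right | mid   = contradiction (inj₂ (inj₂ (refl , refl))) ¬t

    -- As no vertex is on the right of both, the `mid` and `right` parts of `q` lie in the `left`
    -- part of `p` or in the right corner separator. The vertex `v`, which is `left` in both, makes
    -- the inequality strict.
    shrink : size q right < size p left
    shrink = +-cancelʳ-≤ k (suc (size q right)) (size p left) (begin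
      suc (size q right) + k                     ≡⟨ sym (+-suc (size q right) k) ⟩
      size q right + suc k                       ≡⟨ cong (size q right +_) (+-comm 1 k) ⟩
      size q right + (k + 1)                     ≡⟨ cong (size q right +_) (sym (cong₂ _+_ (order q) (#-singleton v))) ⟩
      size q right + (size q mid + # (_≟ v))     ≡⟨ cong (size q right +_) (sym (∑-distrib-+ (χ (λ x → side q x ≟ˢ mid)) (χ (_≟ v)))) ⟩
      size q right + sum (λ x → χ (λ x → side q x ≟ˢ mid) x + χ (_≟ v) x)
        ≡⟨ sym (∑-distrib-+ (χ (λ x → side q x ≟ˢ right)) (λ x → χ (λ x → side q x ≟ˢ mid) x + χ (_≟ v) x)) ⟩
      sum (λ x → χ (λ x → side q x ≟ˢ right) x + (χ (λ x → side q x ≟ˢ mid) x + χ (_≟ v) x))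
        ≤⟨ sum-mono (λ x → pointwise x (x ≟ v)) ⟩
      sum (λ x → χ (λ x → side p x ≟ˢ left) x + χ (T? right) x)
        ≡⟨ ∑-distrib-+ (χ (λ x → side p x ≟ˢ left)) (χ (T? right)) ⟩
      size p left + # (T? right)                 ≤⟨ +-monoʳ-≤ (size p left) corner-right ⟩
      size p left + k                            ∎)
      where
      open ≤-Reasoning
      pointwise : ∀ x (d : Dec (x ≡ v)) →
        𝟙 (does (side q x ≟ˢ right)) + (𝟙 (does (side q x ≟ˢ mid)) + 𝟙 (does d))
          ≤ 𝟙 (does (side p x ≟ˢ left)) + 𝟙 (does (T? right x))
      pointwise x (yes refl) rewrite at-u p | at-u q = ≤-refl
      pointwise x (no _) with side p x in px | side q x in qx
      ... | right | right = contradiction qx (no-right-right x px)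
      ... | mid   | left  = z≤n
      ... | left  | left  = z≤n
      ... | right | left  = z≤n
      ... | mid   | mid   = ≤-refl
      ... | left  | mid   = ≤-refl
      ... | right | mid   = ≤-refl
      ... | mid   | right = ≤-refl
      ... | left  | right = ≤-refl

    -- A neighbour of `u` on the left of `p` must be `v`. One on the left of `q` is adjacent to the
    -- twin `w` as well, so it is `v` too. All others lie in the right corner separator, which
    -- leaves `u` a degree of at most `k + 1`.
    no-twins : 2 + k ≤ # (adj? G u) → ¬ Twins G u w
    no-twins deg-u tw = <⇒≱ deg-u (≤-trans
        (#-mono (adj? G u) (λ y → T? right y ⊎-dec (y ≟ v)) around)
        (≤-trans (#-insert (T? right) v) (s≤s corner-right)))
      where
      around : ∀ y → Adj G u y → Corner right (side p y) (side q y) ⊎ y ≡ v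
      around y uy with y ≟ w
      ... | yes refl = inj₁ (inj₂ (inj₁ (p-w , at-v q)))
      ... | no y≢w with side p y in py | side q y in qy
      ...   | left  | _     = inj₂ (proj₁ (only p py (at-v p) (Adj-sym G uy)))
      ...   | mid   | left  = inj₂ (proj₁ (only q qy (at-v q) (Adj-sym G (Twins.to tw y≢w uy))))
      ...   | right | left  = inj₂ (proj₁ (only q qy (at-v q) (Adj-sym G (Twins.to tw y≢w uy))))
      ...   | mid   | mid   = inj₁ (inj₁ (refl , refl))
      ...   | mid   | right = inj₁ (inj₂ (inj₁ (refl , refl)))
      ...   | right | mid   = inj₁ (inj₂ (inj₂ (refl , refl)))
      ...   | right | right = contradiction qy (no-right-right y py)

  -- Going around the triangle, the sides would shrink forever.
  no-split-triangle : Connected (suc k) G → ∀ {v u w} → Split G k v u → Split G k v w → Split G k u w →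
    Adj G v u → Adj G v w → Adj G u w →
    2 + k ≤ # (adj? G v) → 2 + k ≤ # (adj? G u) → 2 + k ≤ # (adj? G w) → ⊥
  no-split-triangle conn p q r vu vw uw dv du dw = n≮n (size q left) (begin-strict
    size q left            ≡⟨ sym (size-flip q left) ⟩
    size (flip q) right    <⟨ shrink conn (flip r) (flip q) (Adj-sym G uw) (Adj-sym G vw) (Adj-sym G vu) dw ⟩
    size (flip r) left     ≡⟨ size-flip r right ⟩
    size r right           <⟨ shrink conn (flip p) r (Adj-sym G vu) uw vw du ⟩
    size (flip p) left     ≡⟨ size-flip p right ⟩
    size p right           <⟨ shrink conn q p vw vu (Adj-sym G uw) dv ⟩
    size q left            ∎)
    where
    open ≤-Reasoning
    open Triangle using (shrink)

-- Heavy neighbours and the final count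

twins-unique : ∀ {n} {G : Graph n} {v a b} → Twins G v a → Twins G v b → Adj G v b → b ≢ a → ⊥
twins-unique ta tb vb b≢a with Twins.exit ta b≢a vb
... | z , bz , z≢v , ¬vz = ¬vz (Twins.from tb z≢v bz)

heavy? : ∀ {n} (G : Graph n) k x → Dec (2 + k ≤ # (adj? G x))
heavy? G k x = 2 + k ≤? # (adj? G x)

module _ {n : ℕ} {G : Graph n} {k : ℕ} (cf : ClawFree G) (conn : Connected (suc k) G) (2≤k : 2 ≤ k)
         (mfc : MinimalFactorCritical k G) where

  no-three-splits : ∀ {v a b c} → Split G k v a → Split G k v b → Split G k v c →
    Adj G v a → Adj G v b → Adj G v c → a ≢ b → b ≢ c → a ≢ c →
    2 + k ≤ # (adj? G v) → 2 + k ≤ # (adj? G a) → 2 + k ≤ # (adj? G b) → 2 + k ≤ # (adj? G c) → ⊥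
  no-three-splits {v} pa pb pc va vb vc a≢b b≢c a≢c dv da db dc =
    claw-free G cf va vb vc a≢b b≢c a≢c (apart pa pb va vb da db) (apart pb pc vb vc db dc) (apart pa pc va vc da dc)
    where
    apart : ∀ {u w} → Split G k v u → Split G k v w → Adj G v u → Adj G v w →
            2 + k ≤ # (adj? G u) → 2 + k ≤ # (adj? G w) → ¬ Adj G u w
    apart p q vu vw du dw uw with edge-type cf conn 2≤k mfc uw du dw
    ... | inj₁ r = no-split-triangle conn p q r vu vw uw dv du dw
    ... | inj₂ t = Triangle.no-twins conn p q vu vw uw dv du t

  -- The bound is two splits plus one twin: among four edges there are three splits or two twins.
  heavy-neighbours : ∀ v → 2 + k ≤ # (adj? G v) → # (λ w → adj? G v w ×-dec heavy? G k w) ≤ 3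
  heavy-neighbours v dv = ≮⇒≥ four
    where
    P? : ∀ w → Dec (Adj G v w × 2 + k ≤ # (adj? G w))
    P? w = adj? G v w ×-dec heavy? G k w
    four : ¬ (3 < # P?)
    four lt with #-pick P? lt
    ... | a , (va , da) , lt₁ with #-pick (_-?_ P? a) lt₁
    ... | b , ((vb , db) , b≢a) , lt₂ with #-pick (_-?_ (_-?_ P? a) b) lt₂
    ... | c , (((vc , dc) , c≢a) , c≢b) , lt₃ with #-pick (_-?_ (_-?_ (_-?_ P? a) b) c) lt₃
    ... | d , ((((vd , dd) , d≢a) , d≢b) , d≢c) , _
      with edge-type cf conn 2≤k mfc va dv da | edge-type cf conn 2≤k mfc vb dv db
         | edge-type cf conn 2≤k mfc vc dv dc | edge-type cf conn 2≤k mfc vd dv dd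
    ... | inj₁ pa | inj₁ pb | inj₁ pc | _       = no-three-splits pa pb pc va vb vc (b≢a ∘ sym) (c≢b ∘ sym) (c≢a ∘ sym) dv da db dc
    ... | inj₁ pa | inj₁ pb | inj₂ _  | inj₁ pd = no-three-splits pa pb pd va vb vd (b≢a ∘ sym) (d≢b ∘ sym) (d≢a ∘ sym) dv da db dd
    ... | inj₁ pa | inj₂ _  | inj₁ pc | inj₁ pd = no-three-splits pa pc pd va vc vd (c≢a ∘ sym) (d≢c ∘ sym) (d≢a ∘ sym) dv da dc dd
    ... | inj₂ _  | inj₁ pb | inj₁ pc | inj₁ pd = no-three-splits pb pc pd vb vc vd (c≢b ∘ sym) (d≢c ∘ sym) (d≢b ∘ sym) dv db dc dd
    ... | inj₂ ta | inj₂ tb | _       | _       = twins-unique ta tb vb b≢a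
    ... | inj₂ ta | inj₁ _  | inj₂ tc | _       = twins-unique ta tc vc c≢a
    ... | inj₂ ta | inj₁ _  | inj₁ _  | inj₂ td = twins-unique ta td vd d≢a
    ... | inj₁ _  | inj₂ tb | inj₂ tc | _       = twins-unique tb tc vc c≢b
    ... | inj₁ _  | inj₂ tb | inj₁ _  | inj₂ td = twins-unique tb td vd d≢b
    ... | inj₁ _  | inj₁ _  | inj₂ tc | inj₂ td = twins-unique tc td vd d≢c

-- A non-neighbour of `u` is cut off from it by the neighbours of `u`. If there is none, `u` is
-- adjacent to all other vertices, and `t < n`.
min-degree : ∀ {n t} {G : Graph n} → Connected t G → ∀ u → t ≤ # (adj? G u)
min-degree {n} {t} {G} conn u with any? (λ z → ¬? (z ≟ u) ×-dec ¬? (adj? G u z))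
... | yes (z , z≢u , ¬uz) = cut conn {C = _≡ u} (adj? G u) refl (λ uu → Adj⇒≢ G uu refl) z≢u ¬uz
        (λ { refl uy ¬uy → contradiction uy ¬uy })
... | no none = ≤-pred (≤-trans (proj₁ conn) (≤-trans
        (≤-reflexive (sym (#-all (λ z → adj? G u z ⊎-dec (z ≟ u)) everyone))) (#-insert (adj? G u) u)))
  where
  everyone : ∀ z → Adj G u z ⊎ z ≡ u
  everyone z with z ≟ u | adj? G u z
  ... | yes e | _      = inj₂ e
  ... | no _  | yes uz = inj₁ uz
  ... | no ne | no ¬uz = contradiction (z , ne , ¬uz) none

numDegree-# : ∀ {n} (G : Graph n) d → numDegree G d ≡ # (λ u → # (adj? G u) ℕ.≟ d)
numDegree-# G d = trans (size-tabulate (λ u → ⌊ degree G u ℕ.≟ d ⌋)) (trans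
  (sum-cong-≗ (λ u → cong 𝟙 (isYes≗does (degree G u ℕ.≟ d))))
  (#-cong (λ u → degree G u ℕ.≟ d) (λ u → # (adj? G u) ℕ.≟ d)
    (λ u → trans (sym (degree-# G u))) (λ u → trans (degree-# G u))))

theorem1p5 : (k n : ℕ) (G : Graph n) → 1 ≤ k →
    ClawFree G → MinimalFactorCritical k G → Connected (suc k) G →
    (k ∸ 1) * n ≤ (2 * k) * numDegree G (suc k)
theorem1p5 (suc zero) n G 1≤k cf mfc conn = z≤n
theorem1p5 (suc (suc j)) n G 1≤k cf mfc conn = begin
  suc j * n                                        ≤⟨ *-monoʳ-≤ (suc j) n≤h+t ⟩
  suc j * (h + t)                                  ≡⟨ *-distribˡ-+ (suc j) h t ⟩
  suc j * h + suc j * t                            ≤⟨ +-monoˡ-≤ (suc j * t) edges ⟩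
  (3 + j) * t + suc j * t                          ≡⟨ identity j t ⟩
  2 * suc (suc j) * t                              ≡⟨ cong (2 * suc (suc j) *_) (sym (numDegree-# G (3 + j))) ⟩
  2 * suc (suc j) * numDegree G (3 + j)            ∎
  where
  open ≤-Reasoning
  k : ℕ
  k = 2 + j
  light? : ∀ x → Dec (# (adj? G x) ≡ suc k)
  light? x = # (adj? G x) ℕ.≟ suc k
  h t : ℕ
  h = # (heavy? G k)
  t = # light?
  heavy-or-light : ∀ x → 2 + k ≤ # (adj? G x) ⊎ # (adj? G x) ≡ suc k
  heavy-or-light x with m≤n⇒m<n∨m≡n (min-degree conn x)
  ... | inj₁ lt = inj₁ lt
  ... | inj₂ e  = inj₂ (sym e)
  n≤h+t : n ≤ h + t
  n≤h+t = ≤-trans (≤-reflexive (sym (#-all (λ x → heavy? G k x ⊎-dec light? x) heavy-or-light))) (#-∪ (heavy? G k) light?)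
  identity : ∀ j t → (3 + j) * t + suc j * t ≡ 2 * suc (suc j) * t
  identity = solve-∀
  pair? : ∀ v w → Dec (2 + k ≤ # (adj? G v) × Adj G v w × # (adj? G w) ≡ suc k)
  pair? v w = heavy? G k v ×-dec adj? G v w ×-dec light? w
  from-heavy : ∀ v → suc j * χ (heavy? G k) v ≤ # (pair? v)
  from-heavy v = case (heavy? G k v)
    where
    case : (d : Dec (2 + k ≤ # (adj? G v))) → suc j * 𝟙 (does d) ≤ # (pair? v)
    case (no _)   = ≤-trans (≤-reflexive (*-zeroʳ (suc j))) z≤n
    -- A heavy degree is at least `k + 2`, that is 3 plus `k - 1`. At most three of the neighbours
    -- are heavy, and the others have degree exactly `k + 1`.
    case (yes dv) = ≤-trans (≤-reflexive (*-identityʳ (suc j))) (+-cancelˡ-≤ 3 (suc j) (# (pair? v)) (begin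
      3 + suc j   ≤⟨ dv ⟩
      # (adj? G v)  ≡⟨ sym (#-split (adj? G v) (heavy? G k)) ⟩
      # (λ w → adj? G v w ×-dec heavy? G k w) + # (λ w → adj? G v w ×-dec ¬? (heavy? G k w))
        ≤⟨ +-mono-≤ (heavy-neighbours cf conn (s≤s (s≤s z≤n)) mfc v dv)
             (#-mono (λ w → adj? G v w ×-dec ¬? (heavy? G k w)) (pair? v) (λ w (vw , ¬dw) → dv , vw , light w ¬dw)) ⟩
      3 + # (pair? v)  ∎))
      where
      light : ∀ w → ¬ (2 + k ≤ # (adj? G w)) → # (adj? G w) ≡ suc k
      light w ¬dw with heavy-or-light w
      ... | inj₁ dw = contradiction dw ¬dw
      ... | inj₂ e  = e
  to-light : ∀ w → # (λ v → pair? v w) ≤ suc k * χ light? w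
  to-light w = case (light? w)
    where
    case : (d : Dec (# (adj? G w) ≡ suc k)) → # (λ v → pair? v w) ≤ suc k * 𝟙 (does d)
    case (no ¬l) = ≤-trans (#-empty (λ v → pair? v w) (λ v (_ , _ , l) → ¬l l)) z≤n
    case (yes l) = ≤-trans (#-mono (λ v → pair? v w) (adj? G w) (λ v (_ , vw , _) → Adj-sym G vw))
      (≤-reflexive (trans l (sym (*-identityʳ (suc k)))))
  edges : suc j * h ≤ (3 + j) * t
  edges = begin
    suc j * h                                       ≡⟨ *-distribˡ-sum (suc j) (χ (heavy? G k)) ⟩
    sum (λ v → suc j * χ (heavy? G k) v)            ≤⟨ sum-mono from-heavy ⟩
    sum (λ v → sum (λ w → 𝟙 (does (pair? v w))))    ≡⟨ ∑-comm (λ v w → 𝟙 (does (pair? v w))) ⟩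
    sum (λ w → sum (λ v → 𝟙 (does (pair? v w))))    ≤⟨ sum-mono to-light ⟩
    sum (λ w → suc k * χ light? w)                  ≡⟨ sym (*-distribˡ-sum (suc k) (χ light?)) ⟩
    suc k * t                                       ∎
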